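{- Let $0<k<1$, let $Q=[0,1]\times[0,1]$ with two-dimensional Lebesgue measure $\mu$, and let $Q_1$ be the interior of the square, with sides parallel to those of $Q$, of side length $k$ centered at $(\tfrac12,\tfrac12)$. For $\lambda\in[0,1]$ let $$\phi(\lambda)=\mu\big(\{(x,y)\in Q : y\le\lambda\}\setminus Q_1\big),$$ $$T^0(\phi(\lambda))=\{(x,y)\in Q : y\le\lambda\}\setminus Q_1,\qquad T^1(\phi(\lambda))=\{(x,y)\in Q : y\ge 1-\lambda\}\setminus Q_1,$$ and let $\mathcal{T}^0=\{T^0(\phi(\lambda)) : 0\le\lambda\le 1\}$. Define on $\mathcal{T}^0$ $$T^0(\phi(a))\oplus T^0(\phi(b))=T^0\big(\mu[T^0(\phi(a))\cup T^1(\phi(b))]\big),\qquad \neg T^0(\phi(\lambda))=T^0\big((1-k^2)-\phi(\lambda)\big),$$ and let $0=T^0(0)$ and $1=T^0(1-k^2)=Q\setminus Q_1$. Then $(\mathcal{T}^0,\oplus,\neg,0,1)$ is an MV-algebra.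
   Context: The sets $T^0(t)$ and $T^1(t)$ are parameterized by their measure $t=\phi(\lambda)\in[0,1-k^2]$: for $t\in[0,1-k^2]$, $T^0(t)$ means $T^0(\phi(\lambda))$ for the $\lambda\in[0,1]$ with $\phi(\lambda)=t$, and similarly for $T^1(t)$. An MV-algebra is a structure $(A,\oplus,\neg,0,1)$ such that $(A,\oplus,0)$ is a commutative monoid with identity $0$, and for all $x,y\in A$: (i) $\neg(\neg x)=x$; (ii) $1\oplus x=1$; (iii) $x\oplus\neg 0=\neg 0$; (iv) $\neg(\neg x\oplus y)\oplus y=\neg(\neg y\oplus x)\oplus x$. -}

module Defs where

open import Level using (Level; _⊔_; 0ℓ) renaming (suc to lsuc)
open import Algebra.Core using (Op₁; Op₂)
open import Algebra.Bundles using (CommutativeRing)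
open import Algebra.Definitions using (Congruent₁; Invertible)
open import Algebra.Structures using (IsCommutativeMonoid)
import Algebra.Definitions.RawMonoid as RawMonoidDefs
import Algebra.Properties.Ring as RingProps
open import Data.Fin.Base using (toℕ)
open import Data.Nat.Base as ℕ using (ℕ)
open import Data.Product.Base using (Σ; ∃; ∃-syntax; _×_; _,_; proj₁; proj₂)
open import Data.Sum.Base using (inj₁; inj₂)
open import Function.Base using (_∘_)
open import Relation.Binary.Bundles using (Poset)
open import Relation.Binary.Core using (Rel)
open import Relation.Binary.Structures using (IsTotalOrder)
import Relation.Binary.Construct.NonStrictToStrict as ToStrict
import Relation.Binary.Reasoning.PartialOrder as PosetReasoning
open import Relation.Nullary.Negation using (¬_; contradiction)
open import Relation.Unary using (Pred; _∈_; _⊆_; _≐_; _∩_; _∪_; _∖_; Satisfiable)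
open import Relation.Unary.Properties using (≐-refl)

private
  variable
    a ℓ : Level

record IsMVAlgebra {A : Set a} (_≈_ : Rel A ℓ) (_⊕_ : Op₂ A) (neg : Op₁ A)
                   (0# 1# : A) : Set (a ⊔ ℓ) where
  field
    isCommutativeMonoid : IsCommutativeMonoid _≈_ _⊕_ 0#
    neg-cong            : Congruent₁ _≈_ neg
    neg-involutive      : ∀ x → neg (neg x) ≈ x
    1-zeroˡ             : ∀ x → (1# ⊕ x) ≈ 1#
    neg0-zeroʳ          : ∀ x → (x ⊕ neg 0#) ≈ neg 0#
    exchange            : ∀ x y → (neg (neg x ⊕ y) ⊕ y) ≈ (neg (neg y ⊕ x) ⊕ x)

module Bounds {A : Set} (_≤_ : Rel A 0ℓ) where
  UpperBound LowerBound : Pred A 0ℓ → Pred A 0ℓ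
  UpperBound S u = ∀ {s} → s ∈ S → s ≤ u
  LowerBound S l = ∀ {s} → s ∈ S → l ≤ s

  IsLub IsGlb : Pred A 0ℓ → Pred A 0ℓ
  IsLub S u = UpperBound S u × (∀ {v} → UpperBound S v → u ≤ v)
  IsGlb S l = LowerBound S l × (∀ {m} → LowerBound S m → m ≤ l)

-- The real numbers, characterised (up to isomorphism) as the Dedekind-complete
-- ordered field.  The equality _≈_ is a setoid equality, so Cauchy sequences
-- are an admissible carrier.
record CompleteOrderedField : Set₁ where
  field
    commutativeRing : CommutativeRing 0ℓ 0ℓ

  open CommutativeRing commutativeRing public

  infix 4 _≤_

  field
    _≤_          : Rel Carrier 0ℓ
    isTotalOrder : IsTotalOrder _≈_ _≤_
    0≉1          : ¬ (0# ≈ 1#)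
    inverse      : ∀ {x} → ¬ (x ≈ 0#) → Invertible _≈_ 1# _*_ x
    +-monoˡ-≤    : ∀ z {x y} → x ≤ y → (x + z) ≤ (y + z)
    *-nonneg     : ∀ {x y} → 0# ≤ x → 0# ≤ y → 0# ≤ (x * y)

  open Bounds _≤_ public

  field
    complete : ∀ (S : Pred Carrier 0ℓ) → Satisfiable S →
               Satisfiable (UpperBound S) → ∃ (IsLub S)

  infix 4 _<_
  _<_ : Rel Carrier 0ℓ
  _<_ = ToStrict._<_ _≈_ _≤_

  infima : ∀ (S : Pred Carrier 0ℓ) → Satisfiable S →
           Satisfiable (LowerBound S) → ∃ (IsGlb S)
  infima S (s , s∈S) bounded with complete (LowerBound S) bounded (s , λ l → l s∈S)
  ... | m , upper , least = m , (λ t∈S → least (λ l → l t∈S)) , upper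

  open IsTotalOrder isTotalOrder public
    using (total; isPartialOrder; antisym; ≤-respˡ-≈; ≤-respʳ-≈)
    renaming (refl to ≤-refl; reflexive to ≤-reflexive; trans to ≤-trans)

  poset : Poset 0ℓ 0ℓ 0ℓ
  poset = record { isPartialOrder = isPartialOrder }

module _ (R : CompleteOrderedField) where
  open CompleteOrderedField R
  open RingProps ring using (-1*x≈-x; -‿involutive)
  open PosetReasoning poset

  0≤1 : 0# ≤ 1#
  0≤1 with total 0# 1#
  ... | inj₁ p = p
  ... | inj₂ q = begin
    0#              ≤⟨ *-nonneg 0≤-1 0≤-1 ⟩
    (- 1#) * (- 1#) ≈⟨ -1*x≈-x (- 1#) ⟩
    - (- 1#)        ≈⟨ -‿involutive 1# ⟩
    1#              ∎
    where
    0≤-1 : 0# ≤ (- 1#)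
    0≤-1 = begin
      0#          ≈⟨ -‿inverseʳ 1# ⟨
      1# + (- 1#) ≤⟨ +-monoˡ-≤ (- 1#) q ⟩
      0# + (- 1#) ≈⟨ +-identityˡ (- 1#) ⟩
      - 1#        ∎

  1≤2 : 1# ≤ (1# + 1#)
  1≤2 = begin
    1#      ≈⟨ +-identityˡ 1# ⟨
    0# + 1# ≤⟨ +-monoˡ-≤ 1# 0≤1 ⟩
    1# + 1# ∎

  1<2 : 1# < (1# + 1#)
  1<2 = 1≤2 , λ 1≈2 → 0≉1 (antisym 0≤1 (begin
    1#                 ≈⟨ +-identityʳ 1# ⟨
    1# + 0#            ≈⟨ +-congˡ (-‿inverseʳ 1#) ⟨
    1# + (1# + (- 1#)) ≈⟨ +-assoc 1# 1# (- 1#) ⟨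
    (1# + 1#) + (- 1#) ≈⟨ +-congʳ 1≈2 ⟨
    1# + (- 1#)        ≈⟨ -‿inverseʳ 1# ⟩
    0#                 ∎))

  2≉0 : ¬ ((1# + 1#) ≈ 0#)
  2≉0 2≈0 = 0≉1 (antisym 0≤1 (≤-trans 1≤2 (≤-reflexive 2≈0)))

  ½ : Carrier
  ½ = proj₁ (inverse 2≉0)

  -1≤0 : (- 1#) ≤ 0#
  -1≤0 = begin
    - 1#        ≈⟨ +-identityˡ (- 1#) ⟨
    0# + (- 1#) ≤⟨ +-monoˡ-≤ (- 1#) 0≤1 ⟩
    1# + (- 1#) ≈⟨ -‿inverseʳ 1# ⟩
    0#          ∎

  -1<0 : (- 1#) < 0#
  -1<0 = -1≤0 , λ -1≈0 → 0≉1 (begin-equality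
    0#          ≈⟨ -‿inverseʳ 1# ⟨
    1# + (- 1#) ≈⟨ +-congˡ -1≈0 ⟩
    1# + 0#     ≈⟨ +-identityʳ 1# ⟩
    1#          ∎)

  <-≤-trans : ∀ {x y z} → x < y → y ≤ z → x < z
  <-≤-trans = ToStrict.<-≤-trans _≈_ _≤_ sym ≤-trans antisym ≤-respʳ-≈

  ≤-<-trans : ∀ {x y z} → x ≤ y → y < z → x < z
  ≤-<-trans = ToStrict.≤-<-trans _≈_ _≤_ ≤-trans antisym ≤-respˡ-≈

  sub-nonneg : ∀ {x y} → x ≤ y → 0# ≤ (y - x)
  sub-nonneg {x} {y} x≤y = begin
    0#    ≈⟨ -‿inverseʳ x ⟨
    x - x ≤⟨ +-monoˡ-≤ (- x) x≤y ⟩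
    y - x ∎

module Plane (R : CompleteOrderedField) where
  open CompleteOrderedField R
  open PosetReasoning poset
  open RawMonoidDefs +-rawMonoid using (sum)

  Point : Set
  Point = Carrier × Carrier

  Region : Set₁
  Region = Pred Point 0ℓ

  UnitInterval : Pred Carrier 0ℓ
  UnitInterval x = (0# ≤ x) × (x ≤ 1#)

  Q : Region
  Q (x , y) = x ∈ UnitInterval × y ∈ UnitInterval

  record Box : Set where
    field
      left right bottom top : Carrier
      left≤right : left ≤ right
      bottom≤top : bottom ≤ top

  open Box

  area : Box → Carrier
  area B = (right B - left B) * (top B - bottom B)

  interior : Box → Region
  interior B (x , y) = ((left B < x) × (x < right B)) × ((bottom B < y) × (y < top B))

  Covers : (ℕ → Box) → Region → Set
  Covers B E = ∀ {p} → p ∈ E → ∃[ n ] p ∈ interior (B n)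

  PartialSum : (ℕ → Carrier) → Pred Carrier 0ℓ
  PartialSum f s = ∃[ n ] s ≈ sum {n} (f ∘ toℕ)

  -- For a series of nonnegative terms, converging to s means that s is the
  -- least upper bound of the partial sums.
  CoverSum : Region → Pred Carrier 0ℓ
  CoverSum E s = ∃[ B ] Covers B E × IsLub (PartialSum (area ∘ B)) s

  CoverSum-nonneg : ∀ E → 0# ∈ LowerBound (CoverSum E)
  CoverSum-nonneg E (B , _ , upper , _) = upper (0 , refl)

  private
    bigBox pointBox : Box
    bigBox = record
      { left = - 1# ; right = 1# + 1# ; bottom = - 1# ; top = 1# + 1#
      ; left≤right = -1≤2 ; bottom≤top = -1≤2 }
      where
      -1≤2 : (- 1#) ≤ (1# + 1#)
      -1≤2 = ≤-trans (-1≤0 R) (≤-trans (0≤1 R) (1≤2 R))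
    pointBox = record
      { left = 0# ; right = 0# ; bottom = 0# ; top = 0#
      ; left≤right = ≤-refl ; bottom≤top = ≤-refl }

    boxes : ℕ → Box
    boxes ℕ.zero    = bigBox
    boxes (ℕ.suc _) = pointBox

    pointBoxes-sum : ∀ n → sum {n} (λ _ → area pointBox) ≈ 0#
    pointBoxes-sum ℕ.zero    = refl
    pointBoxes-sum (ℕ.suc n) = begin-equality
      area pointBox + sum {n} (λ _ → area pointBox) ≈⟨ +-cong (trans (*-congʳ (-‿inverseʳ 0#)) (zeroˡ _)) (pointBoxes-sum n) ⟩
      0# + 0#                                       ≈⟨ +-identityˡ 0# ⟩
      0#                                            ∎

    partialSum-suc : ∀ n → sum {ℕ.suc n} (area ∘ boxes ∘ toℕ) ≈ area bigBox
    partialSum-suc n = trans (+-congˡ (pointBoxes-sum n)) (+-identityʳ _)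

    boxes-sum : IsLub (PartialSum (area ∘ boxes)) (area bigBox)
    boxes-sum = upper , λ bound → bound (1 , sym (partialSum-suc 0))
      where
      upper : UpperBound (PartialSum (area ∘ boxes)) (area bigBox)
      upper (ℕ.zero , s≈) = ≤-trans (≤-reflexive s≈)
        (*-nonneg (sub-nonneg R (left≤right bigBox)) (sub-nonneg R (bottom≤top bigBox)))
      upper (ℕ.suc n , s≈) = ≤-reflexive (trans s≈ (partialSum-suc n))

  CoverSum-satisfiable : ∀ E → E ⊆ Q → Satisfiable (CoverSum E)
  CoverSum-satisfiable E E⊆Q = area bigBox , boxes , (λ p∈E → 0 , inside (E⊆Q p∈E)) , boxes-sum
    where
    inside : ∀ {p} → p ∈ Q → p ∈ interior bigBox
    inside ((0≤x , x≤1) , (0≤y , y≤1)) =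
      (<-≤-trans R (-1<0 R) 0≤x , ≤-<-trans R x≤1 (1<2 R)) ,
      (<-≤-trans R (-1<0 R) 0≤y , ≤-<-trans R y≤1 (1<2 R))

  -- Lebesgue measure on Q: the infimum of the total areas of countable covers
  -- by open boxes.  The Lebesgue measure of a measurable set is by definition
  -- this (outer) value; it is only used below on finite unions of rectangles.
  -- Intersecting with Q changes nothing for subsets of Q.
  measure : ∀ E → ∃ (IsGlb (CoverSum (Q ∩ E)))
  measure E = infima (CoverSum (Q ∩ E)) (CoverSum-satisfiable (Q ∩ E) proj₁)
                     (0# , CoverSum-nonneg (Q ∩ E))

  μ : Region → Carrier
  μ E = proj₁ (measure E)

module PuncturedSquare (R : CompleteOrderedField) (k : CompleteOrderedField.Carrier R) where
  open CompleteOrderedField R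
  open Plane R public

  Q₁ : Region
  Q₁ (x , y) = inside x × inside y
    where
    inside : Pred Carrier 0ℓ
    inside z = ((½ R - ½ R * k) < z) × (z < (½ R + ½ R * k))

  lower upper : Carrier → Region
  lower l = (Q ∩ λ (_ , y) → y ≤ l) ∖ Q₁
  upper l = (Q ∩ λ (_ , y) → (1# - l) ≤ y) ∖ Q₁

  φ : Carrier → Carrier
  φ l = μ (lower l)

  -- T⁰ t is `lower l` for the l in [0,1] with φ l ≈ t, written as the union
  -- over all such l; it is empty if t is not a value of φ.  Likewise for T¹.
  T⁰ T¹ : Carrier → Region
  T⁰ t p = ∃[ l ] l ∈ UnitInterval × φ l ≈ t × p ∈ lower l
  T¹ t p = ∃[ l ] l ∈ UnitInterval × φ l ≈ t × p ∈ upper l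

  𝒯⁰ : Set₁
  𝒯⁰ = Σ Region λ S → ∃[ l ] l ∈ UnitInterval × S ≐ T⁰ (φ l)

  ⟦_⟧ : 𝒯⁰ → Region
  ⟦ S , _ ⟧ = S

  infix 4 _≈𝒯_
  _≈𝒯_ : Rel 𝒯⁰ 0ℓ
  S ≈𝒯 S′ = ⟦ S ⟧ ≐ ⟦ S′ ⟧

  T⁰φ : ∀ l → l ∈ UnitInterval → 𝒯⁰
  T⁰φ l l∈I = T⁰ (φ l) , l , l∈I , ≐-refl

  total-area : Carrier
  total-area = 1# - k * k

  -- As every element of 𝒯⁰ is some T⁰ (φ l), congruent operations are
  -- determined up to _≈𝒯_ by these equations.
  record DefiningEquations (_⊕_ : Op₂ 𝒯⁰) (neg : Op₁ 𝒯⁰) (0𝒯 1𝒯 : 𝒯⁰) : Set where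
    field
      ⊕-def   : ∀ a b (a∈I : a ∈ UnitInterval) (b∈I : b ∈ UnitInterval) →
                ⟦ T⁰φ a a∈I ⊕ T⁰φ b b∈I ⟧ ≐ T⁰ (μ (T⁰ (φ a) ∪ T¹ (φ b)))
      neg-def : ∀ l (l∈I : l ∈ UnitInterval) →
                ⟦ neg (T⁰φ l l∈I) ⟧ ≐ T⁰ (total-area - φ l)
      0-def   : ⟦ 0𝒯 ⟧ ≐ T⁰ 0#
      1-def   : ⟦ 1𝒯 ⟧ ≐ T⁰ total-area
      1≐Q∖Q₁  : ⟦ 1𝒯 ⟧ ≐ (Q ∖ Q₁)

{-# OPTIONS --safe #-}

-- A sweep-line supremum argument, applied first to the rows of Q and then to
-- its height, shows that countably many open boxes covering Q have total area at
-- least 1.  By finite subadditivity a region and its complement in Q, both cut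
-- into boxes, then have the expected measures: for d = ½ − ½ k and e = ½ + ½ k
-- one gets φ a = a − k (clip a − d), where clip truncates to [d , e], and
-- μ (T⁰ (φ a) ∪ T¹ (φ b)) = min (φ a + φ b , 1 − k²).  Since φ is increasing and
-- continuous from 0 to 1 − k², it carries ⊕ and ¬ to the Łukasiewicz operations
-- on [0 , 1 − k²].

module Submission where

open import Level using (0ℓ)
open import Axiom.ExcludedMiddle using (ExcludedMiddle)
open import Algebra.Bundles using (CommutativeRing)
open import Algebra.Core using (Op₁; Op₂)
open import Algebra.Structures using (IsCommutativeMonoid)
import Algebra.Construct.NaturalChoice.Max as Max
import Algebra.Construct.NaturalChoice.Min as Min
import Algebra.Properties.Ring as RingProperties
import Algebra.Properties.Semiring.Mult.TCOptimised as Multiples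
import Algebra.Properties.Semiring.Sum as SemiringSum
import Algebra.Solver.Ring as Solver
import Algebra.Solver.Ring.AlmostCommutativeRing as AlmostCommutative
open import Data.Empty using (⊥-elim)
open import Data.Fin.Base using (Fin; toℕ)
open import Data.Integer.Base as ℤ using (ℤ; -[1+_])
import Data.Integer.Properties as ℤ
open import Data.List.Base using (List; []; _∷_; _++_)
open import Data.List.Relation.Unary.Any using (Any; here; there)
open import Data.List.Relation.Unary.Any.Properties using (++⁺ˡ; ++⁺ʳ)
open import Data.Maybe.Base using (Maybe; map)
open import Data.Nat.Base as ℕ using (ℕ; zero; suc; z≤n; s≤s)
import Data.Nat.Properties as ℕ
open import Data.Product.Base using (Σ; ∃-syntax; _×_; _,_; proj₁; proj₂)
open import Data.Sign.Base as Sign using (Sign)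
open import Data.Sum.Base using (_⊎_; inj₁; inj₂; [_,_]′; map₂)
open import Function.Base using (_∘_)
open import Relation.Binary.Bundles using (TotalOrder)
open import Relation.Binary.Consequences using (dec⇒weaklyDec)
open import Relation.Binary.Core using (Rel)
open import Relation.Binary.PropositionalEquality.Core as ≡ using ()
import Relation.Binary.Reasoning.PartialOrder as PosetReasoning
import Relation.Binary.Reasoning.Setoid as SetoidReasoning
open import Relation.Binary.Structures using (IsEquivalence)
open import Relation.Nullary.Decidable.Core using (Dec; yes; no)
open import Relation.Nullary.Negation using (¬_)
open import Relation.Unary using (Pred; _∈_; _∉_; _∩_; _∪_; _⊆_; _≐_; ∅)
open import Relation.Unary.Properties using (≐-refl; ≐-sym; ≐-trans)
open import Defs

-- The measure is an infimum over covers, so exhibiting a cover only ever bounds it from above. The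
-- one direct lower bound is that of the whole square; any other exact value gets its lower bound by
-- subtracting from it an upper bound for the complement. This works because region and complement
-- are cut into closed boxes of total area exactly 1, the open hole being replaced by its closure at
-- no cost in area.
--
-- Outside the hole, rows have length between 1 - k and 1. The lower bound makes a measure determine
-- its level, so the unions defining `T⁰` and `T¹` collapse to one region. The upper bound yields a
-- level for every measure up to 1 - k²; at any other argument `T⁰` is empty and an operation would
-- leave the carrier.
--
-- The truncation in the sum is geometric: one region grows from the bottom, the other from the top,
-- and once their levels cross they fill the annulus. Associativity is hard to see on regions but
-- easy for truncated addition, hence the transfer to numbers.

module IntegerCoefficients (R : CommutativeRing 0ℓ 0ℓ) where
  open CommutativeRing R
  open RingProperties ring
  open Multiples semiring using (1+×; ×-homo-+; ×1-homo-*) renaming (_×_ to _•_)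
  open SetoidReasoning setoid

  -- The ring solver has to recognise coefficients that cancel. Equality of the abstract reals
  -- offers no algorithm for this, equality of integers does, so polynomials get integer
  -- coefficients that are interpreted by this map.
  ⟦_⟧ : ℤ → Carrier
  ⟦ ℤ.+ n ⟧    = n • 1#
  ⟦ -[1+ n ] ⟧ = - (suc n • 1#)

  signed : Sign → Carrier → Carrier
  signed Sign.+ x = x
  signed Sign.- x = - x

  private
    +-cancel-middle : ∀ u x y → (u + x) - (u + y) ≈ x - y
    +-cancel-middle u x y = begin
      (u + x) - (u + y)         ≈⟨ +-cong (+-comm u x) (sym (-‿+-comm u y)) ⟩
      (x + u) + (- u + - y)     ≈⟨ +-assoc x u _ ⟩
      x + (u + (- u + - y))     ≈⟨ +-congˡ (+-assoc u (- u) (- y)) ⟨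
      x + ((u - u) + - y)       ≈⟨ +-congˡ (+-congʳ (-‿inverseʳ u)) ⟩
      x + (0# + - y)            ≈⟨ +-congˡ (+-identityˡ (- y)) ⟩
      x - y                     ∎

    -‿*-‿ : ∀ x y → - x * - y ≈ x * y
    -‿*-‿ x y = begin
      - x * - y    ≈⟨ -‿distribˡ-* x (- y) ⟨
      - (x * - y)  ≈⟨ -‿cong (-‿distribʳ-* x y) ⟨
      - - (x * y)  ≈⟨ -‿involutive (x * y) ⟩
      x * y        ∎

  ⊖-homo : ∀ m n → ⟦ m ℤ.⊖ n ⟧ ≈ m • 1# - n • 1#
  ⊖-homo m zero = begin
    m • 1#        ≈⟨ +-identityʳ _ ⟨
    m • 1# + 0#   ≈⟨ +-congˡ -0#≈0# ⟨
    m • 1# - 0#   ∎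
  ⊖-homo zero (suc n) = sym (+-identityˡ _)
  ⊖-homo (suc m) (suc n) = begin
    ⟦ suc m ℤ.⊖ suc n ⟧                ≡⟨ ≡.cong ⟦_⟧ (ℤ.[1+m]⊖[1+n]≡m⊖n m n) ⟩
    ⟦ m ℤ.⊖ n ⟧                        ≈⟨ ⊖-homo m n ⟩
    m • 1# - n • 1#                    ≈⟨ +-cancel-middle 1# _ _ ⟨
    (1# + m • 1#) - (1# + n • 1#)      ≈⟨ +-cong (1+× m 1#) (-‿cong (1+× n 1#)) ⟨
    suc m • 1# - suc n • 1#            ∎

  +-homo : ∀ i j → ⟦ i ℤ.+ j ⟧ ≈ ⟦ i ⟧ + ⟦ j ⟧
  +-homo (ℤ.+ m)  (ℤ.+ n)  = ×-homo-+ 1# m n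
  +-homo (ℤ.+ m)  -[1+ n ] = ⊖-homo m (suc n)
  +-homo -[1+ m ] (ℤ.+ n)  = trans (⊖-homo n (suc m)) (+-comm _ _)
  +-homo -[1+ m ] -[1+ n ] = begin
    - (suc (suc (m ℕ.+ n)) • 1#)        ≡⟨ ≡.cong (λ i → - (suc i • 1#)) (ℕ.+-suc m n) ⟨
    - ((suc m ℕ.+ suc n) • 1#)          ≈⟨ -‿cong (×-homo-+ 1# (suc m) (suc n)) ⟩
    - (suc m • 1# + suc n • 1#)         ≈⟨ -‿+-comm _ _ ⟨
    - (suc m • 1#) - (suc n • 1#)       ∎

  ◃-homo : ∀ s n → ⟦ s ℤ.◃ n ⟧ ≈ signed s (n • 1#)
  ◃-homo Sign.+ zero    = refl
  ◃-homo Sign.- zero    = sym -0#≈0#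
  ◃-homo Sign.+ (suc n) = refl
  ◃-homo Sign.- (suc n) = refl

  *-homo : ∀ i j → ⟦ i ℤ.* j ⟧ ≈ ⟦ i ⟧ * ⟦ j ⟧
  *-homo (ℤ.+ m)  (ℤ.+ n)  = trans (◃-homo Sign.+ (m ℕ.* n)) (×1-homo-* m n)
  *-homo (ℤ.+ m)  -[1+ n ] = begin
    ⟦ Sign.- ℤ.◃ (m ℕ.* suc n) ⟧  ≈⟨ ◃-homo Sign.- (m ℕ.* suc n) ⟩
    - ((m ℕ.* suc n) • 1#)        ≈⟨ -‿cong (×1-homo-* m (suc n)) ⟩
    - ((m • 1#) * (suc n • 1#))   ≈⟨ -‿distribʳ-* _ _ ⟩
    (m • 1#) * - (suc n • 1#)     ∎
  *-homo -[1+ m ] (ℤ.+ n)  = begin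
    ⟦ Sign.- ℤ.◃ (suc m ℕ.* n) ⟧  ≈⟨ ◃-homo Sign.- (suc m ℕ.* n) ⟩
    - ((suc m ℕ.* n) • 1#)        ≈⟨ -‿cong (×1-homo-* (suc m) n) ⟩
    - ((suc m • 1#) * (n • 1#))   ≈⟨ -‿distribˡ-* _ _ ⟩
    - (suc m • 1#) * (n • 1#)     ∎
  *-homo -[1+ m ] -[1+ n ] = trans (◃-homo Sign.+ (suc m ℕ.* suc n))
    (trans (×1-homo-* (suc m) (suc n)) (sym (-‿*-‿ _ _)))

  -‿homo : ∀ i → ⟦ ℤ.- i ⟧ ≈ - ⟦ i ⟧
  -‿homo (ℤ.+ zero)  = sym -0#≈0#
  -‿homo (ℤ.+ suc n) = refl
  -‿homo -[1+ n ]    = sym (-‿involutive _)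

  private
    almostCommutativeRing = AlmostCommutative.fromCommutativeRing R

    open AlmostCommutative using (_-Raw-AlmostCommutative⟶_)

    morphism : ℤ.+-*-rawRing -Raw-AlmostCommutative⟶ almostCommutativeRing
    morphism = record
      { ⟦_⟧    = ⟦_⟧
      ; +-homo = +-homo
      ; *-homo = *-homo
      ; -‿homo = -‿homo
      ; 0-homo = refl
      ; 1-homo = refl
      }

    _≟_ : ∀ i j → Maybe (⟦ i ⟧ ≈ ⟦ j ⟧)
    i ≟ j = map (λ { ≡.refl → refl }) (dec⇒weaklyDec ℤ._≟_ i j)

  open Solver ℤ.+-*-rawRing almostCommutativeRing morphism _≟_ public
    using (Polynomial; solve; _:=_; _:+_; _:*_; _:-_; :-_; con)

  :0 :1 : ∀ {n} → Polynomial n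
  :0 = con (ℤ.+ 0)
  :1 = con (ℤ.+ 1)

-- Ordered field arithmetic

module OrderedField (em : ExcludedMiddle 0ℓ) (R : CompleteOrderedField) where
  open CompleteOrderedField R
  open IntegerCoefficients commutativeRing using (solve; _:=_; _:+_; _:*_; _:-_; :-_; :0; :1)
  open Plane R using (UnitInterval)
  open SemiringSum semiring using (sum; ∑-distrib-+; sum-cong-≋; *-distribʳ-sum)
  open PosetReasoning poset

  totalOrder : TotalOrder 0ℓ 0ℓ 0ℓ
  totalOrder = record { isTotalOrder = isTotalOrder }

  open Min totalOrder public
    using (_⊓_; x⊓y≤x; x⊓y≤y; ⊓-glb; ⊓-monoˡ-≤; ⊓-congʳ; x≤y⇒x⊓y≈x)
    renaming (x≤y⇒y⊓x≈x to y≤x⇒x⊓y≈y)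
  open Max totalOrder public
    using (_⊔_; x≤x⊔y; x≤y⊔x; ⊔-lub; ⊔-monoʳ-≤; ⊔-monoˡ-≤; ⊔-congˡ; ⊔-comm; x≤y⇒x⊔y≈y; x≤y⇒y⊔x≈y)

  -- The solver proves ring identities but knows neither the order nor any hypotheses. Inequalities
  -- are therefore reduced to identities between differences, into which `shift` and `shift₂` feed
  -- one or two known inequalities.
  ≤-from-difference : ∀ {x y d} → 0# ≤ d → d ≈ y - x → x ≤ y
  ≤-from-difference {x} {y} {d} 0≤d d≈y-x = begin
    x            ≈⟨ +-identityˡ x ⟨
    0# + x       ≤⟨ +-monoˡ-≤ x 0≤d ⟩
    d + x        ≈⟨ +-congʳ d≈y-x ⟩
    (y - x) + x  ≈⟨ solve 2 (λ x y → (y :- x) :+ x := y) refl x y ⟩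
    y            ∎

  ≈-from-difference : ∀ {x y x′ y′} → x′ ≈ y′ → x - y ≈ x′ - y′ → x ≈ y
  ≈-from-difference {x} {y} {x′} {y′} x′≈y′ eq = begin-equality
    x              ≈⟨ solve 2 (λ x y → x := (x :- y) :+ y) refl x y ⟩
    (x - y) + y    ≈⟨ +-congʳ eq ⟩
    (x′ - y′) + y  ≈⟨ +-congʳ (+-congʳ x′≈y′) ⟩
    (y′ - y′) + y  ≈⟨ solve 2 (λ y y′ → (y′ :- y′) :+ y := y) refl y y′ ⟩
    y              ∎

  +-nonneg : ∀ {x y} → 0# ≤ x → 0# ≤ y → 0# ≤ x + y
  +-nonneg {x} {y} 0≤x 0≤y = begin
    0#      ≤⟨ 0≤y ⟩
    y       ≈⟨ +-identityˡ y ⟨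
    0# + y  ≤⟨ +-monoˡ-≤ y 0≤x ⟩
    x + y   ∎

  shift : ∀ {u v x y} → u ≤ v → v - u ≈ y - x → x ≤ y
  shift u≤v = ≤-from-difference (sub-nonneg R u≤v)

  shift₂ : ∀ {u v u′ v′ x y} → u ≤ v → u′ ≤ v′ → (v - u) + (v′ - u′) ≈ y - x → x ≤ y
  shift₂ u≤v u′≤v′ = ≤-from-difference (+-nonneg (sub-nonneg R u≤v) (sub-nonneg R u′≤v′))

  +-mono-≤ : ∀ {x y u v} → x ≤ y → u ≤ v → x + u ≤ y + v
  +-mono-≤ {x} {y} {u} {v} x≤y u≤v = shift₂ x≤y u≤v
    (solve 4 (λ x y u v → (y :- x) :+ (v :- u) := (y :+ v) :- (x :+ u)) refl x y u v)

  *-monoˡ-≤ : ∀ {c x y} → 0# ≤ c → x ≤ y → c * x ≤ c * y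
  *-monoˡ-≤ {c} {x} {y} 0≤c x≤y = ≤-from-difference (*-nonneg 0≤c (sub-nonneg R x≤y))
    (solve 3 (λ c x y → c :* (y :- x) := c :* y :- c :* x) refl c x y)

  ≤-or-> : ∀ x y → x ≤ y ⊎ y < x
  ≤-or-> x y with em {x ≤ y} | total x y
  ... | yes x≤y | _        = inj₁ x≤y
  ... | no x≰y  | inj₁ x≤y = inj₁ x≤y
  ... | no x≰y  | inj₂ y≤x = inj₂ (y≤x , λ y≈x → x≰y (≤-reflexive (sym y≈x)))

  <⇒≱ : ∀ {x y} → x < y → ¬ (y ≤ x)
  <⇒≱ (x≤y , x≉y) y≤x = x≉y (antisym x≤y y≤x)

  ≰⇒> : ∀ {x y} → ¬ (x ≤ y) → y < x
  ≰⇒> {x} {y} x≰y with ≤-or-> x y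
  ... | inj₁ x≤y = ⊥-elim (x≰y x≤y)
  ... | inj₂ y<x = y<x

  ≮⇒≥ : ∀ {x y} → ¬ (x < y) → y ≤ x
  ≮⇒≥ {x} {y} x≮y with ≤-or-> y x
  ... | inj₁ y≤x = y≤x
  ... | inj₂ x<y = ⊥-elim (x≮y x<y)

  sub-pos : ∀ {x y} → x < y → 0# < y - x
  sub-pos {x} {y} x<y = ≰⇒> λ y-x≤0 → <⇒≱ x<y (shift y-x≤0
    (solve 2 (λ x y → :0 :- (y :- x) := x :- y) refl x y))

  +-pos : ∀ x {δ} → 0# < δ → x < x + δ
  +-pos x {δ} 0<δ = ≰⇒> λ x+δ≤x → <⇒≱ 0<δ (shift x+δ≤x
    (solve 2 (λ x δ → x :- (x :+ δ) := :0 :- δ) refl x δ))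

  -‿pos : ∀ x {δ} → 0# < δ → x - δ < x
  -‿pos x {δ} 0<δ = ≰⇒> λ x≤x-δ → <⇒≱ 0<δ (shift x≤x-δ
    (solve 2 (λ x δ → (x :- δ) :- x := :0 :- δ) refl x δ))

  ⊓-pos : ∀ {x y} → 0# < x → 0# < y → 0# < x ⊓ y
  ⊓-pos {x} {y} 0<x 0<y with total x y
  ... | inj₁ _ = 0<x
  ... | inj₂ _ = 0<y

  *-pos : ∀ {x y} → 0# < x → 0# < y → 0# < x * y
  *-pos {x} {y} (0≤x , 0≉x) (0≤y , 0≉y) = *-nonneg 0≤x 0≤y , λ 0≈xy →
    let x⁻¹ , x⁻¹x≈1 , _ = inverse (λ x≈0 → 0≉x (sym x≈0)) in
    0≉y (begin-equality
      0#             ≈⟨ zeroʳ x⁻¹ ⟨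
      x⁻¹ * 0#       ≈⟨ *-congˡ 0≈xy ⟩
      x⁻¹ * (x * y)  ≈⟨ *-assoc x⁻¹ x y ⟨
      (x⁻¹ * x) * y  ≈⟨ *-congʳ x⁻¹x≈1 ⟩
      1# * y         ≈⟨ *-identityˡ y ⟩
      y              ∎)

  positive-inverse : ∀ {x} → 0# < x → ∃[ x⁻¹ ] 0# < x⁻¹ × x⁻¹ * x ≈ 1#
  positive-inverse {x} (0≤x , 0≉x) with inverse (λ x≈0 → 0≉x (sym x≈0))
  ... | x⁻¹ , x⁻¹x≈1 , _ = x⁻¹ , ≰⇒> x⁻¹≰0 , x⁻¹x≈1
    where
    x⁻¹≰0 : ¬ (x⁻¹ ≤ 0#)
    x⁻¹≰0 x⁻¹≤0 = <⇒≱ (-1<0 R) (begin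
      0#               ≤⟨ *-nonneg (sub-nonneg R x⁻¹≤0) 0≤x ⟩
      (0# - x⁻¹) * x   ≈⟨ solve 2 (λ x⁻¹ x → (:0 :- x⁻¹) :* x := :- (x⁻¹ :* x)) refl x⁻¹ x ⟩
      - (x⁻¹ * x)      ≈⟨ -‿cong x⁻¹x≈1 ⟩
      - 1#             ∎)

  -- If D = x − y were positive, the slack δ = D / (D + C) would give δ C < D.
  ≤-from-small-slack : ∀ {x y C} → 0# ≤ C →
    (∀ {δ} → 0# < δ → δ ≤ 1# → x ≤ y + δ * C) → x ≤ y
  ≤-from-small-slack {x} {y} {C} 0≤C slack = ≮⇒≥ contradictory
    where
    contradictory : ¬ (y < x)
    contradictory y<x = <⇒≱ 0<δD (shift₂ (slack 0<δ δ≤1) (≤-reflexive δ[D+C]≈D)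
        (solve 4 (λ x y C δ → (y :+ δ :* C :- x) :+ ((x :- y) :- δ :* ((x :- y) :+ C)) := :0 :- δ :* (x :- y)) refl x y C δ))
      where
      D = x - y
      0<D = sub-pos y<x
      0<D+C : 0# < D + C
      0<D+C = <-≤-trans R 0<D (shift 0≤C (solve 2 (λ D C → C :- :0 := (D :+ C) :- D) refl D C))
      reciprocal = positive-inverse 0<D+C
      r = proj₁ reciprocal
      0<r = proj₁ (proj₂ reciprocal)
      δ = D * r
      0<δ = *-pos 0<D 0<r
      0<δD = *-pos 0<δ 0<D
      δ[D+C]≈D : δ * (D + C) ≈ D
      δ[D+C]≈D = begin-equality
        D * r * (D + C)    ≈⟨ *-assoc D r _ ⟩
        D * (r * (D + C))  ≈⟨ *-congˡ (proj₂ (proj₂ reciprocal)) ⟩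
        D * 1#             ≈⟨ *-identityʳ D ⟩
        D                  ∎
      δ≤1 : δ ≤ 1#
      δ≤1 = begin
        D * r        ≈⟨ *-comm D r ⟩
        r * D        ≤⟨ *-monoˡ-≤ (proj₁ 0<r) (shift 0≤C (solve 2 (λ D C → C :- :0 := (D :+ C) :- D) refl D C)) ⟩
        r * (D + C)  ≈⟨ proj₂ (proj₂ reciprocal) ⟩
        1#           ∎

  clip : Carrier → Carrier → Carrier → Carrier
  clip l r x = l ⊔ (x ⊓ r)

  module _ {l r : Carrier} where
    clip-below : ∀ {x} → l ≤ r → x ≤ l → clip l r x ≈ l
    clip-below {x} l≤r x≤l = x≤y⇒y⊔x≈y (≤-trans (x⊓y≤x x r) x≤l)

    clip-between : ∀ {x} → l ≤ x → x ≤ r → clip l r x ≈ x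
    clip-between {x} l≤x x≤r = trans (⊔-congˡ l x⊓r≈x) (x≤y⇒x⊔y≈y l≤x)
      where x⊓r≈x = x≤y⇒x⊓y≈x x≤r

    clip-above : ∀ {x} → l ≤ r → r ≤ x → clip l r x ≈ r
    clip-above {x} l≤r r≤x = trans (⊔-congˡ l (y≤x⇒x⊓y≈y r≤x)) (x≤y⇒x⊔y≈y l≤r)

    clip-mono-≤ : ∀ {x y} → x ≤ y → clip l r x ≤ clip l r y
    clip-mono-≤ x≤y = ⊔-monoʳ-≤ l (⊓-monoˡ-≤ r x≤y)

    l≤clip : ∀ x → l ≤ clip l r x
    l≤clip x = x≤x⊔y l (x ⊓ r)

    clip≤r : ∀ x → l ≤ r → clip l r x ≤ r
    clip≤r x l≤r = ⊔-lub l≤r (x⊓y≤y x r)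

    -- Only differences of this identity are used: `l + r` cancels, and a rise from one level to
    -- another splits into its parts below `l`, between `l` and `r`, and above `r`.
    clip-decomposition : l ≤ r → ∀ x → (x ⊓ l) + clip l r x + (x ⊔ r) ≈ x + l + r
    clip-decomposition l≤r x = cases (total x l) (total x r)
      where
      cases : x ≤ l ⊎ l ≤ x → x ≤ r ⊎ r ≤ x →
              (x ⊓ l) + clip l r x + (x ⊔ r) ≈ x + l + r
      cases (inj₁ x≤l) _ = begin-equality
        (x ⊓ l) + clip l r x + (x ⊔ r)  ≈⟨ +-cong (+-cong (x≤y⇒x⊓y≈x x≤l) (clip-below l≤r x≤l)) (x≤y⇒x⊔y≈y (≤-trans x≤l l≤r)) ⟩
        x + l + r                       ∎
      cases (inj₂ l≤x) (inj₁ x≤r) = begin-equality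
        (x ⊓ l) + clip l r x + (x ⊔ r)  ≈⟨ +-cong (+-cong (y≤x⇒x⊓y≈y l≤x) (clip-between l≤x x≤r)) (x≤y⇒x⊔y≈y x≤r) ⟩
        l + x + r                       ≈⟨ +-congʳ (+-comm l x) ⟩
        x + l + r                       ∎
      cases (inj₂ l≤x) (inj₂ r≤x) = begin-equality
        (x ⊓ l) + clip l r x + (x ⊔ r)  ≈⟨ +-cong (+-cong (y≤x⇒x⊓y≈y l≤x) (clip-above l≤r r≤x)) (x≤y⇒y⊔x≈y r≤x) ⟩
        l + r + x                       ≈⟨ solve 3 (λ x l r → l :+ r :+ x := x :+ l :+ r) refl x l r ⟩
        x + l + r                       ∎

  -- Finite sums, indicators and the sweep

  ∑ : ℕ → (ℕ → Carrier) → Carrier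
  ∑ n f = sum {n} (f ∘ toℕ)

  sum-mono-≤ : ∀ n {f g : Fin n → Carrier} → (∀ i → f i ≤ g i) → sum f ≤ sum g
  sum-mono-≤ zero    f≤g = ≤-refl
  sum-mono-≤ (suc n) f≤g = +-mono-≤ (f≤g Fin.zero) (sum-mono-≤ n (f≤g ∘ Fin.suc))

  ∑-nonneg : ∀ n {f} → (∀ i → 0# ≤ f i) → 0# ≤ ∑ n f
  ∑-nonneg zero    0≤f = ≤-refl
  ∑-nonneg (suc n) 0≤f = +-nonneg (0≤f 0) (∑-nonneg n (0≤f ∘ suc))

  ∑-extend : ∀ {m n} {f : ℕ → Carrier} → (∀ i → 0# ≤ f i) → m ℕ.≤ n → ∑ m f ≤ ∑ n f
  ∑-extend {n = n} 0≤f z≤n       = ∑-nonneg n 0≤f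
  ∑-extend         0≤f (s≤s m≤n) = +-mono-≤ ≤-refl (∑-extend (0≤f ∘ suc) m≤n)

  term≤∑ : ∀ n {f : ℕ → Carrier} → (∀ i → 0# ≤ f i) → f n ≤ ∑ (suc n) f
  term≤∑ zero {f} 0≤f = ≤-reflexive (sym (+-identityʳ (f 0)))
  term≤∑ (suc n) {f} 0≤f = begin
    f (suc n)                 ≤⟨ term≤∑ n (0≤f ∘ suc) ⟩
    ∑ (suc n) (f ∘ suc)       ≈⟨ +-identityˡ _ ⟨
    0# + ∑ (suc n) (f ∘ suc)  ≤⟨ +-mono-≤ (0≤f 0) ≤-refl ⟩
    ∑ (suc (suc n)) f         ∎

  indicator : Set → Carrier
  indicator P with em {P}
  ... | yes _ = 1#
  ... | no  _ = 0#

  indicator-true : ∀ {P : Set} → P → indicator P ≈ 1#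
  indicator-true {P} p with em {P}
  ... | yes _ = refl
  ... | no ¬p = ⊥-elim (¬p p)

  indicator-nonneg : ∀ (P : Set) → 0# ≤ indicator P
  indicator-nonneg P with em {P}
  ... | yes _ = 0≤1 R
  ... | no  _ = ≤-refl

  -- Demanding the property for all `ε ≤ δ`, not just at one `ε`, lets finitely many thresholds be
  -- merged by taking their minimum.
  Small : Pred Carrier 0ℓ → Set
  Small P = ∃[ δ ] 0# < δ × (∀ {ε} → ε ≤ δ → P ε)

  small-everywhere : ∀ n {P : Fin n → Pred Carrier 0ℓ} →
    (∀ i → Small (P i)) → Small (λ ε → ∀ i → P i ε)
  small-everywhere zero small = 1# , (0≤1 R , 0≉1) , λ _ ()
  small-everywhere (suc n) {P} small =
    δ , ⊓-pos (proj₁ (proj₂ (small Fin.zero))) (proj₁ (proj₂ rest)) , λ where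
      ε≤δ Fin.zero    → proj₂ (proj₂ (small Fin.zero)) (≤-trans ε≤δ (x⊓y≤x δ₀ δ₁))
      ε≤δ (Fin.suc i) → proj₂ (proj₂ rest) (≤-trans ε≤δ (x⊓y≤y δ₀ δ₁)) i
    where
    rest = small-everywhere n (small ∘ Fin.suc)
    δ₀ = proj₁ (small Fin.zero)
    δ₁ = proj₁ rest
    δ = δ₀ ⊓ δ₁

  -- A one-dimensional Heine–Borel and Fubini argument in one: x is compared with
  -- the weighted length that finitely many intervals have to the left of x, and
  -- the supremum of the x for which the comparison succeeds can only be 1.
  module Sweep (c l r : ℕ → Carrier) (0≤c : ∀ n → 0# ≤ c n) (l≤r : ∀ n → l n ≤ r n) where
    weightAt : Carrier → ℕ → Carrier
    weightAt x n = indicator (l n < x × x < r n) * c n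

    weightAt-nonneg : ∀ x n → 0# ≤ weightAt x n
    weightAt-nonneg x n = *-nonneg (indicator-nonneg (l n < x × x < r n)) (0≤c n)

    swept : Carrier → ℕ → Carrier
    swept x n = c n * (clip (l n) (r n) x - l n)

    swept-nonneg : ∀ x n → 0# ≤ swept x n
    swept-nonneg x n = *-nonneg (0≤c n) (sub-nonneg R (l≤clip x))

    swept-mono-≤ : ∀ {x y} n → x ≤ y → swept x n ≤ swept y n
    swept-mono-≤ n x≤y = *-monoˡ-≤ (0≤c n) (+-monoˡ-≤ (- l n) (clip-mono-≤ x≤y))

    increment : Carrier → Carrier → ℕ → Carrier
    increment x y n = swept y n - swept x n

    increment-nonneg : ∀ {x y} → x ≤ y → ∀ n → 0# ≤ increment x y n
    increment-nonneg x≤y n = sub-nonneg R (swept-mono-≤ n x≤y)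

    Growth : Carrier → ℕ → Pred Carrier 0ℓ
    Growth x n ε = ∀ {y z} → x - ε ≤ y → y ≤ z → z ≤ x + ε →
      weightAt x n * (z - y) ≤ increment y z n

    -- An interval containing `x` is swept at rate `c n` near `x`. For the others monotonicity
    -- suffices; equality may fail there, since an interval can begin at `x` without containing it.
    growth : ∀ x n → Small (Growth x n)
    growth x n with em {l n < x × x < r n}
    ... | no _ = 1# , (0≤1 R , 0≉1) , λ {ε} _ {y} {z} _ y≤z _ → begin
      0# * c n * (z - y)  ≈⟨ solve 2 (λ c t → :0 :* c :* t := :0) refl (c n) (z - y) ⟩
      0#                  ≤⟨ increment-nonneg y≤z n ⟩
      increment y z n     ∎
    -- The threshold is the distance from `x` to the nearer endpoint, so `y` and `z` stay where
    -- `clip` is the identity.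
    ... | yes (l<x , x<r) = (x - l n) ⊓ (r n - x) , ⊓-pos (sub-pos l<x) (sub-pos x<r) , λ {ε} ε≤δ {y} {z} x-ε≤y y≤z z≤x+ε →
      let l≤y : l n ≤ y
          l≤y = shift₂ (≤-trans ε≤δ (x⊓y≤x (x - l n) (r n - x))) x-ε≤y
            (solve 4 (λ l x ε y → ((x :- l) :- ε) :+ (y :- (x :- ε)) := y :- l) refl (l n) x ε y)
          z≤r : z ≤ r n
          z≤r = shift₂ (≤-trans ε≤δ (x⊓y≤y (x - l n) (r n - x))) z≤x+ε
            (solve 4 (λ r x ε z → ((r :- x) :- ε) :+ ((x :+ ε) :- z) := r :- z) refl (r n) x ε z)
      in begin
        1# * c n * (z - y)                 ≈⟨ solve 4 (λ c l y z → :1 :* c :* (z :- y) := c :* (z :- l) :- c :* (y :- l)) refl (c n) (l n) y z ⟩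
        c n * (z - l n) - c n * (y - l n)  ≈⟨ +-cong (*-congˡ (+-congʳ (clip-between (≤-trans l≤y y≤z) z≤r))) (-‿cong (*-congˡ (+-congʳ (clip-between l≤y (≤-trans y≤z z≤r))))) ⟨
        increment y z n                    ∎

    ∑-increment : ∀ n x y → ∑ n (swept x) + ∑ n (increment x y) ≈ ∑ n (swept y)
    ∑-increment n x y = begin-equality
      ∑ n (swept x) + ∑ n (increment x y)            ≈⟨ ∑-distrib-+ {n} (swept x ∘ toℕ) (increment x y ∘ toℕ) ⟨
      ∑ n (λ i → swept x i + increment x y i)        ≈⟨ sum-cong-≋ {n} (λ i → solve 2 (λ a b → a :+ (b :- a) := b) refl (swept x (toℕ i)) (swept y (toℕ i))) ⟩
      ∑ n (swept y)                                  ∎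

    Reached : Pred Carrier 0ℓ
    Reached x = x ∈ UnitInterval × ∃[ n ] x ≤ ∑ n (swept x)

    module _ (covering : ∀ x → x ∈ UnitInterval → ∃[ n ] 1# ≤ ∑ n (weightAt x)) where

      -- The step `δ` depends on `x` alone and not on the reached point `y`. A point reached just
      -- below a supremum can thus be carried beyond it.
      extend : ∀ x → x ∈ UnitInterval → ∃[ δ ] 0# < δ × (∀ {y z} → y ∈ Reached →
        x - δ ≤ y → y ≤ z → z ≤ x + δ → z ≤ 1# → z ∈ Reached)
      extend x x∈I with covering x x∈I
      ... | m , 1≤weight with small-everywhere m (growth x ∘ toℕ)
      ... | δ , 0<δ , growing = δ , 0<δ , further
        where
        further : ∀ {y z} → y ∈ Reached → x - δ ≤ y → y ≤ z → z ≤ x + δ → z ≤ 1# → z ∈ Reached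
        further {y} {z} ((0≤y , _) , n , y≤swept) x-δ≤y y≤z z≤x+δ z≤1 =
          (≤-trans 0≤y y≤z , z≤1) , N , (begin
            z                                    ≈⟨ solve 2 (λ y z → z := y :+ (z :- y)) refl y z ⟩
            y + (z - y)                          ≤⟨ +-mono-≤ y≤swept z-y≤increments ⟩
            ∑ n (swept y) + ∑ m (increment y z)  ≤⟨ +-mono-≤ (∑-extend (swept-nonneg y) (ℕ.m≤m⊔n n m)) (∑-extend (increment-nonneg y≤z) (ℕ.m≤n⊔m n m)) ⟩
            ∑ N (swept y) + ∑ N (increment y z)  ≈⟨ ∑-increment N y z ⟩
            ∑ N (swept z)                        ∎)
          where
          N = n ℕ.⊔ m
          z-y≤increments : z - y ≤ ∑ m (increment y z)
          z-y≤increments = begin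
            z - y                                ≈⟨ *-identityʳ (z - y) ⟨
            (z - y) * 1#                         ≤⟨ *-monoˡ-≤ (sub-nonneg R y≤z) 1≤weight ⟩
            (z - y) * ∑ m (weightAt x)           ≈⟨ *-comm (z - y) _ ⟩
            ∑ m (weightAt x) * (z - y)           ≈⟨ *-distribʳ-sum {m} (z - y) (weightAt x ∘ toℕ) ⟩
            ∑ m (λ i → weightAt x i * (z - y))   ≤⟨ sum-mono-≤ m (λ i → growing ≤-refl i x-δ≤y y≤z z≤x+δ) ⟩
            ∑ m (increment y z)                  ∎

      0-reached : 0# ∈ Reached
      0-reached = (≤-refl , 0≤1 R) , 0 , ≤-refl

      1-reached : 1# ∈ Reached
      1-reached with complete Reached (0# , 0-reached) (1# , proj₂ ∘ proj₁)
      ... | x , upper , least with extend x (upper 0-reached , least (proj₂ ∘ proj₁))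
      ... | δ , 0<δ , further with em {∃[ y ] y ∈ Reached × x - δ ≤ y}
      -- With nothing reached in the last `δ` below `x`, already `x - δ` would be an upper bound.
      ... | no none = ⊥-elim (<⇒≱ (-‿pos x 0<δ) (least λ {y} y∈ → proj₁ (≰⇒> λ x-δ≤y → none (y , y∈ , x-δ≤y))))
      ... | yes (y , y∈ , x-δ≤y) with total (x + δ) 1#
      -- A step to `x + δ` inside the unit interval would overtake the supremum. In the other case
      -- the step can be stopped at 1.
      ... | inj₁ x+δ≤1 = ⊥-elim (<⇒≱ (+-pos x 0<δ) (upper (further y∈ x-δ≤y
              (≤-trans (upper y∈) (proj₁ (+-pos x 0<δ))) ≤-refl x+δ≤1)))
      ... | inj₂ 1≤x+δ = further y∈ x-δ≤y (proj₂ (proj₁ y∈)) 1≤x+δ ≤-refl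

      sweep : ∃[ n ] 1# ≤ ∑ n (λ i → c i * (r i - l i))
      sweep with 1-reached
      ... | _ , n , 1≤swept = n , (begin
        1#                             ≤⟨ 1≤swept ⟩
        ∑ n (swept 1#)                 ≤⟨ sum-mono-≤ n (λ i → *-monoˡ-≤ (0≤c (toℕ i)) (+-monoˡ-≤ (- l (toℕ i)) (clip≤r 1# (l≤r (toℕ i))))) ⟩
        ∑ n (λ i → c i * (r i - l i))  ∎)

-- Outer measure and finite unions of boxes

module Measure (em : ExcludedMiddle 0ℓ) (R : CompleteOrderedField) where
  open CompleteOrderedField R
  open IntegerCoefficients commutativeRing using (solve; _:=_; _:+_; _:*_; _:-_; :0; :1)
  open OrderedField em R
  open Plane R
  open Box
  open SemiringSum semiring using (sum-cong-≋; sum-replicate-zero)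
  open PosetReasoning poset

  closed : Box → Region
  closed B (x , y) = ((left B ≤ x) × (x ≤ right B)) × ((bottom B ≤ y) × (y ≤ top B))

  ⋃ : List Box → Region
  ⋃ L p = Any (λ B → p ∈ closed B) L

  areas : List Box → Carrier
  areas []      = 0#
  areas (B ∷ L) = area B + areas L

  areas-++ : ∀ L M → areas (L ++ M) ≈ areas L + areas M
  areas-++ []      M = sym (+-identityˡ (areas M))
  areas-++ (B ∷ L) M = trans (+-congˡ (areas-++ L M)) (sym (+-assoc (area B) (areas L) (areas M)))

  module _ (B : Box) where
    enlarge : ∀ {δ} → 0# ≤ δ → Box
    enlarge {δ} 0≤δ = record
      { left       = left B - δ
      ; right      = right B + δ
      ; bottom     = bottom B - δ
      ; top        = top B + δ
      ; left≤right = widen (left≤right B)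
      ; bottom≤top = widen (bottom≤top B)
      }
      where
      widen : ∀ {x y} → x ≤ y → x - δ ≤ y + δ
      widen {x} {y} x≤y = shift₂ x≤y (+-nonneg 0≤δ 0≤δ)
        (solve 3 (λ x y δ → (y :- x) :+ ((δ :+ δ) :- :0) := (y :+ δ) :- (x :- δ)) refl x y δ)

    closed⊆interior-enlarge : ∀ {δ} (0<δ : 0# < δ) → closed B ⊆ interior (enlarge (proj₁ 0<δ))
    closed⊆interior-enlarge {δ} 0<δ ((l≤x , x≤r) , (b≤y , y≤t)) =
      (<-≤-trans R (-‿pos (left B) 0<δ) l≤x , ≤-<-trans R x≤r (+-pos (right B) 0<δ)) ,
      (<-≤-trans R (-‿pos (bottom B) 0<δ) b≤y , ≤-<-trans R y≤t (+-pos (top B) 0<δ))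

    halfPerimeter : Carrier
    halfPerimeter = (right B - left B) + (top B - bottom B)

    -- For width w and height h, enlarging by `δ` adds 2δ(w + h) + 4δ² to the area. For `δ ≤ 1` the
    -- square is at most 4δ, which gives this linear rate; the gap left over is 4δ(1 - δ).
    slope : Carrier
    slope = (halfPerimeter + halfPerimeter) + ((1# + 1#) + (1# + 1#))

    slope-nonneg : 0# ≤ slope
    slope-nonneg = +-nonneg (+-nonneg 0≤w+h 0≤w+h) (+-nonneg 0≤2 0≤2)
      where
      0≤2 = +-nonneg (0≤1 R) (0≤1 R)
      0≤w+h = +-nonneg (sub-nonneg R (left≤right B)) (sub-nonneg R (bottom≤top B))

    area-enlarge : ∀ {δ} (0≤δ : 0# ≤ δ) → δ ≤ 1# → area (enlarge 0≤δ) ≤ area B + δ * slope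
    area-enlarge {δ} 0≤δ δ≤1 = ≤-from-difference (*-nonneg 0≤4 (*-nonneg 0≤δ (sub-nonneg R δ≤1)))
      (solve 5 (λ l r b t δ →
        ((:1 :+ :1) :+ (:1 :+ :1)) :* (δ :* (:1 :- δ)) :=
        ((r :- l) :* (t :- b) :+ δ :* ((((r :- l) :+ (t :- b)) :+ ((r :- l) :+ (t :- b))) :+ ((:1 :+ :1) :+ (:1 :+ :1))))
          :- ((r :+ δ) :- (l :- δ)) :* ((t :+ δ) :- (b :- δ)))
        refl (left B) (right B) (bottom B) (top B) δ)
      where 0≤4 = +-nonneg (+-nonneg (0≤1 R) (0≤1 R)) (+-nonneg (0≤1 R) (0≤1 R))

  area-nonneg : ∀ B → 0# ≤ area B
  area-nonneg B = *-nonneg (sub-nonneg R (left≤right B)) (sub-nonneg R (bottom≤top B))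

  infixr 5 _◂_
  _◂_ : Box → (ℕ → Box) → ℕ → Box
  (B ◂ C) zero    = B
  (B ◂ C) (suc n) = C n

  ◂-sum : ∀ B {C s} → IsLub (PartialSum (area ∘ C)) s →
          IsLub (PartialSum (area ∘ (B ◂ C))) (area B + s)
  ◂-sum B {C} {s} (upper , least) = upper′ , λ {v} upper-v → least′ v upper-v
    where
    upper′ : UpperBound (PartialSum (area ∘ (B ◂ C))) (area B + s)
    upper′ (zero , t≈)  = ≤-trans (≤-reflexive t≈) (+-nonneg (area-nonneg B) (upper (0 , refl)))
    upper′ (suc n , t≈) = ≤-trans (≤-reflexive t≈) (+-mono-≤ ≤-refl (upper (n , refl)))

    least′ : ∀ v → UpperBound (PartialSum (area ∘ (B ◂ C))) v → area B + s ≤ v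
    least′ v upper-v = shift (least {v - area B} λ {t} (n , t≈) → shift (upper-v (suc n , +-congˡ t≈))
        (solve 3 (λ a t v → v :- (a :+ t) := (v :- a) :- t) refl (area B) t v))
      (solve 3 (λ a s v → (v :- a) :- s := v :- (a :+ s)) refl (area B) s v)

  μ≤ : ∀ E {s} → CoverSum (Q ∩ E) s → μ E ≤ s
  μ≤ E = proj₁ (proj₂ (measure E))

  ≤μ : ∀ E {m} → LowerBound (CoverSum (Q ∩ E)) m → m ≤ μ E
  ≤μ E = proj₂ (proj₂ (measure E))

  -- A closed box is not covered by its own interior, so a slightly enlarged copy is put in front of
  -- an arbitrary cover of `E`. The bound holds for every such cover, hence for the infimum, and
  -- then the enlargement tends to zero.
  μ-∪-box : ∀ {F} E B → (Q ∩ F) ⊆ (E ∪ closed B) → μ F ≤ area B + μ E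
  μ-∪-box {F} E B F⊆E∪B = ≤-from-small-slack (slope-nonneg B) λ {δ} 0<δ δ≤1 →
    shift (≤μ E {μ F - (area B + δ * slope B)} λ {s} (C , covers , lub) →
        shift₂ (μ≤ F {area (enlarge B (proj₁ 0<δ)) + s}
                (enlarge B (proj₁ 0<δ) ◂ C , covers′ 0<δ covers , ◂-sum (enlarge B (proj₁ 0<δ)) lub))
               (area-enlarge B (proj₁ 0<δ) δ≤1)
          (solve 4 (λ m a b s → ((a :+ s) :- m) :+ (b :- a) := s :- (m :- b)) refl
            (μ F) (area (enlarge B (proj₁ 0<δ))) (area B + δ * slope B) s))
      (solve 4 (λ m a b c → c :- (m :- (a :+ b)) := ((a :+ c) :+ b) :- m) refl (μ F) (area B) (δ * slope B) (μ E))
    where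
    covers′ : ∀ {δ} (0<δ : 0# < δ) {C} → Covers C (Q ∩ E) →
              Covers (enlarge B (proj₁ 0<δ) ◂ C) (Q ∩ F)
    covers′ 0<δ covers p∈@(p∈Q , _) with F⊆E∪B p∈
    ... | inj₁ p∈E = let n , p∈C = covers (p∈Q , p∈E) in suc n , p∈C
    ... | inj₂ p∈B = 0 , closed⊆interior-enlarge B 0<δ p∈B

  -- The remainder `E` lets one statement serve three ends: monotonicity for empty `L`, an upper
  -- bound for `μ F` when `E` is empty, and a lower bound for `μ E` when `F` is the square.
  μ-∪-boxes : ∀ {F} E L → (Q ∩ F) ⊆ (E ∪ ⋃ L) → μ F ≤ areas L + μ E
  μ-∪-boxes {F} E [] F⊆E = begin
    μ F       ≤⟨ ≤μ E (λ (C , covers , lub) → μ≤ F (C , (λ p∈ → covers (proj₁ p∈ , in-E p∈)) , lub)) ⟩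
    μ E       ≈⟨ +-identityˡ (μ E) ⟨
    0# + μ E  ∎
    where
    in-E : (Q ∩ F) ⊆ E
    in-E p∈ with F⊆E p∈
    ... | inj₁ p∈E = p∈E
  μ-∪-boxes {F} E (B ∷ L) F⊆E∪B∪L = begin
    μ F                         ≤⟨ μ-∪-boxes (E ∪ closed B) L regroup ⟩
    areas L + μ (E ∪ closed B)  ≤⟨ +-mono-≤ ≤-refl (μ-∪-box E B proj₂) ⟩
    areas L + (area B + μ E)    ≈⟨ solve 3 (λ l b e → l :+ (b :+ e) := (b :+ l) :+ e) refl (areas L) (area B) (μ E) ⟩
    area B + areas L + μ E      ∎
    where
    regroup : (Q ∩ F) ⊆ ((E ∪ closed B) ∪ ⋃ L)
    regroup p∈ with F⊆E∪B∪L p∈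
    ... | inj₁ p∈E         = inj₁ (inj₁ p∈E)
    ... | inj₂ (here p∈B)  = inj₁ (inj₂ p∈B)
    ... | inj₂ (there p∈L) = inj₂ p∈L

  μ-mono : ∀ {E F} → (Q ∩ F) ⊆ E → μ F ≤ μ E
  μ-mono {E} F⊆E = ≤-trans (μ-∪-boxes E [] (inj₁ ∘ F⊆E)) (≤-reflexive (+-identityˡ (μ E)))

  μ∅≤0 : μ ∅ ≤ 0#
  μ∅≤0 = μ≤ ∅ ((λ _ → point) , (λ p∈ → ⊥-elim (proj₂ p∈)) ,
    (λ (n , s≈) → ≤-reflexive (trans s≈ (vanishing n))) , λ upper → upper (0 , refl))
    where
    point : Box
    point = record
      { left = 0# ; right = 0# ; bottom = 0# ; top = 0# ; left≤right = ≤-refl ; bottom≤top = ≤-refl }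
    vanishing : ∀ n → ∑ n (λ _ → area point) ≈ 0#
    vanishing n = trans
      (sum-cong-≋ {n} (λ _ → solve 1 (λ z → (z :- z) :* (z :- z) := :0) refl 0#))
      (sum-replicate-zero n)

  1≤μQ : 1# ≤ μ Q
  1≤μQ = ≤μ Q λ (B , covers , upper , _) →
    let n , 1≤area = covered-area B covers in ≤-trans 1≤area (upper (n , refl))
    where
    module _ (B : ℕ → Box) (covers : Covers B (Q ∩ Q)) where
      meets : Carrier → ℕ → Carrier
      meets y n = indicator (bottom (B n) < y × y < top (B n))

      module Horizontal (y : Carrier) = Sweep (meets y) (left ∘ B) (right ∘ B)
        (λ n → indicator-nonneg (bottom (B n) < y × y < top (B n))) (left≤right ∘ B)

      module Vertical = Sweep (λ n → right (B n) - left (B n)) (bottom ∘ B) (top ∘ B)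
        (λ n → sub-nonneg R (left≤right (B n))) (bottom≤top ∘ B)

      row : ∀ y → y ∈ UnitInterval → ∀ x → x ∈ UnitInterval →
            ∃[ n ] 1# ≤ ∑ n (Horizontal.weightAt y x)
      row y y∈I x x∈I with covers ((x∈I , y∈I) , (x∈I , y∈I))
      -- One box around the point already contributes weight 1; the sum needs length `suc n` to
      -- include the term of index `n`.
      ... | n , x∈B , y∈B = suc n , (begin
        1#                                 ≈⟨ *-identityˡ 1# ⟨
        1# * 1#                            ≈⟨ *-cong (indicator-true x∈B) (indicator-true y∈B) ⟨
        Horizontal.weightAt y x n          ≤⟨ term≤∑ n (Horizontal.weightAt-nonneg y x) ⟩
        ∑ (suc n) (Horizontal.weightAt y x) ∎)

      covered-area : ∃[ n ] 1# ≤ ∑ n (area ∘ B)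
      -- The total width found by sweeping the row at height `y` is definitionally the weight that
      -- the vertical sweep requires at `y`: a Fubini argument for covers.
      covered-area = Vertical.sweep λ y y∈I → Horizontal.sweep y (row y y∈I)

  -- Covering `F` bounds its measure from above, covering the rest of the square bounds it from
  -- below through `1≤μQ`, and total area 1 leaves no gap between the bounds.
  μ-exact : ∀ F L M → (Q ∩ F) ⊆ ⋃ L → Q ⊆ (F ∪ ⋃ M) → areas L + areas M ≈ 1# → μ F ≈ areas L
  μ-exact F L M F⊆L Q⊆F∪M L+M≈1 = antisym
    (begin
      μ F              ≤⟨ μ-∪-boxes ∅ L (inj₂ ∘ F⊆L) ⟩
      areas L + μ ∅    ≤⟨ +-mono-≤ ≤-refl μ∅≤0 ⟩
      areas L + 0#     ≈⟨ +-identityʳ (areas L) ⟩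
      areas L          ∎)
    (shift (≤-trans (≤-reflexive L+M≈1) (≤-trans 1≤μQ (μ-∪-boxes F M (Q⊆F∪M ∘ proj₁))))
      (solve 3 (λ f l m → (m :+ f) :- (l :+ m) := f :- l) refl (μ F) (areas L) (areas M)))

-- Intermediate values of monotone 1-Lipschitz functions

module IntermediateValue (em : ExcludedMiddle 0ℓ) (R : CompleteOrderedField) where
  open CompleteOrderedField R
  open IntegerCoefficients commutativeRing using (solve; _:=_; _:+_; _:-_; :1)
  open OrderedField em R
  open Plane R using (UnitInterval)

  -- The Lipschitz bound turns the error `f x - t` at the supremum `x` into a step length: moving
  -- `x` by that amount cannot overshoot `t`.
  intermediate-value : ∀ (f : Carrier → Carrier) →
    (∀ {x y} → x ≤ y → f x ≤ f y) → (∀ {x y} → x ≤ y → f y - f x ≤ y - x) →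
    ∀ {t} → f 0# ≤ t → t ≤ f 1# → ∃[ x ] x ∈ UnitInterval × f x ≈ t
  intermediate-value f mono lipschitz {t} f0≤t t≤f1
    with complete (λ x → x ∈ UnitInterval × f x ≤ t) (0# , (≤-refl , 0≤1 R) , f0≤t) (1# , proj₂ ∘ proj₁)
  ... | x , upper , least = x , x∈I , antisym (≮⇒≥ t≮fx) (≮⇒≥ fx≮t)
    where
    x∈I : x ∈ UnitInterval
    x∈I = upper ((≤-refl , 0≤1 R) , f0≤t) , least (proj₂ ∘ proj₁)

    t≮fx : ¬ (t < f x)
    t≮fx t<fx = <⇒≱ (-‿pos x (sub-pos t<fx)) (least λ {s} s∈@(_ , fs≤t) →
      shift₂ (lipschitz (upper s∈)) fs≤t
        (solve 5 (λ x s t fx fs → ((x :- s) :- (fx :- fs)) :+ (t :- fs) := (x :- (fx :- t)) :- s) refl x s t (f x) (f s)))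

    fx≮t : ¬ (f x < t)
    fx≮t fx<t with total (x + (t - f x)) 1#
    ... | inj₁ z≤1 = <⇒≱ x<z (upper ((≤-trans (proj₁ x∈I) (proj₁ x<z) , z≤1) ,
            shift (lipschitz (proj₁ x<z))
              (solve 4 (λ x t fx fz → ((x :+ (t :- fx)) :- x) :- (fz :- fx) := t :- fz) refl x t (f x) (f (x + (t - f x))))))
      where x<z = +-pos x (sub-pos fx<t)
    -- If the step leaves the interval, the Lipschitz bound from `x` to 1 gives `f 1# ≤ t`. Then 1
    -- belongs to the set with supremum `x`, so `t ≤ f 1# ≤ f x`.
    ... | inj₂ 1≤z = <⇒≱ fx<t (≤-trans t≤f1 (mono (upper ((0≤1 R , ≤-refl) ,
            shift₂ (lipschitz (proj₂ x∈I)) 1≤z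
              (solve 4 (λ x t fx f1 → ((:1 :- x) :- (f1 :- fx)) :+ ((x :+ (t :- fx)) :- :1) := t :- f1) refl x t (f x) (f 1#))))))

-- Truncated addition and its transfer

module Łukasiewicz (em : ExcludedMiddle 0ℓ) (R : CompleteOrderedField)
                   (T : CompleteOrderedField.Carrier R) where
  open CompleteOrderedField R
  open IntegerCoefficients commutativeRing using (solve; _:=_; _:+_; _:-_; :0)
  open OrderedField em R
  open PosetReasoning poset

  infixl 6 _⊞_
  _⊞_ : Op₂ Carrier
  x ⊞ y = (x + y) ⊓ T

  ⊞-cong : ∀ {x y u v} → x ≈ y → u ≈ v → x ⊞ u ≈ y ⊞ v
  ⊞-cong x≈y u≈v = ⊓-congʳ T (+-cong x≈y u≈v)

  ⊞-comm : ∀ x y → x ⊞ y ≈ y ⊞ x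
  ⊞-comm x y = ⊓-congʳ T (+-comm x y)

  ⊞-small : ∀ {x y} → x + y ≤ T → x ⊞ y ≈ x + y
  ⊞-small = x≤y⇒x⊓y≈x

  ⊞-large : ∀ {x y} → T ≤ x + y → x ⊞ y ≈ T
  ⊞-large = y≤x⇒x⊓y≈y

  ⊞-nonneg : ∀ {x y} → 0# ≤ T → 0# ≤ x → 0# ≤ y → 0# ≤ x ⊞ y
  ⊞-nonneg 0≤T 0≤x 0≤y = ⊓-glb (+-nonneg 0≤x 0≤y) 0≤T

  -- Once `x` exceeds `T`, adding a nonnegative `y` keeps the sum above `T`, so the outer truncation
  -- hides the inner one. Associativity thereby reduces to that of ordinary addition.
  truncate-⊞ : ∀ x {y} → 0# ≤ y → (x ⊓ T) ⊞ y ≈ x ⊞ y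
  truncate-⊞ x {y} 0≤y with total x T
  ... | inj₁ _ = refl
  ... | inj₂ T≤x = trans (⊞-large T≤T+y) (sym (⊞-large (≤-trans T≤T+y (+-monoˡ-≤ y T≤x))))
    where
    T≤T+y : T ≤ T + y
    T≤T+y = shift 0≤y (solve 2 (λ T y → y :- :0 := (T :+ y) :- T) refl T y)

  ⊞-assoc : ∀ {x z} y → 0# ≤ x → 0# ≤ z → x ⊞ y ⊞ z ≈ x ⊞ (y ⊞ z)
  ⊞-assoc {x} {z} y 0≤x 0≤z = begin-equality
    x ⊞ y ⊞ z          ≈⟨ truncate-⊞ (x + y) 0≤z ⟩
    (x + y) ⊞ z        ≈⟨ ⊓-congʳ T (solve 3 (λ x y z → (x :+ y) :+ z := (y :+ z) :+ x) refl x y z) ⟩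
    (y + z) ⊞ x        ≈⟨ truncate-⊞ (y + z) 0≤x ⟨
    (y ⊞ z) ⊞ x        ≈⟨ ⊞-comm (y ⊞ z) x ⟩
    x ⊞ (y ⊞ z)        ∎

  ⊞-identityˡ : ∀ {x} → x ≤ T → 0# ⊞ x ≈ x
  ⊞-identityˡ {x} x≤T = trans (⊞-small (≤-trans (≤-reflexive (+-identityˡ x)) x≤T)) (+-identityˡ x)

  ⊞-zeroˡ : ∀ {x} → 0# ≤ x → T ⊞ x ≈ T
  ⊞-zeroˡ {x} 0≤x = ⊞-large (shift 0≤x (solve 2 (λ T x → x :- :0 := (T :+ x) :- T) refl T x))

  -- The nested expression of the exchange axiom is the lattice join, whose symmetry is evident.
  ⊞-max : ∀ {x y} → x ≤ T → y ≤ T → (T - ((T - x) ⊞ y)) ⊞ y ≈ x ⊔ y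
  ⊞-max {x} {y} x≤T y≤T = cases (total x y)
    where
    cases : x ≤ y ⊎ y ≤ x → (T - ((T - x) ⊞ y)) ⊞ y ≈ x ⊔ y
    cases (inj₁ x≤y) = begin-equality
      (T - ((T - x) ⊞ y)) ⊞ y  ≈⟨ ⊞-cong (+-congˡ (-‿cong (⊞-large (shift x≤y (solve 3 (λ x y T → y :- x := ((T :- x) :+ y) :- T) refl x y T))))) refl ⟩
      (T - T) ⊞ y              ≈⟨ ⊞-cong (-‿inverseʳ T) refl ⟩
      0# ⊞ y                   ≈⟨ ⊞-identityˡ y≤T ⟩
      y                        ≈⟨ x≤y⇒x⊔y≈y x≤y ⟨
      x ⊔ y                    ∎
    cases (inj₂ y≤x) = begin-equality
      (T - ((T - x) ⊞ y)) ⊞ y  ≈⟨ ⊞-cong (+-congˡ (-‿cong (⊞-small (shift y≤x (solve 3 (λ x y T → x :- y := T :- ((T :- x) :+ y)) refl x y T))))) refl ⟩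
      (T - ((T - x) + y)) ⊞ y  ≈⟨ ⊓-congʳ T (solve 3 (λ x y T → (T :- ((T :- x) :+ y)) :+ y := x) refl x y T) ⟩
      x ⊓ T                    ≈⟨ x≤y⇒x⊓y≈x x≤T ⟩
      x                        ≈⟨ x≤y⇒y⊔x≈y y≤x ⟨
      x ⊔ y                    ∎

  ⊞-exchange : ∀ {x y} → x ≤ T → y ≤ T → (T - ((T - x) ⊞ y)) ⊞ y ≈ (T - ((T - y) ⊞ x)) ⊞ x
  ⊞-exchange {x} {y} x≤T y≤T = trans (⊞-max x≤T y≤T) (trans (⊔-comm x y) (sym (⊞-max y≤T x≤T)))

  -- All axioms are equations, so they may be checked after applying the injective `m`. Congruence
  -- of the operations is obtained in the same way.
  module Pullback {A : Set₁} (_∼_ : Rel A 0ℓ) (isEquivalence : IsEquivalence _∼_)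
    (m : A → Carrier)
    (m-cong : ∀ x y → x ∼ y → m x ≈ m y)
    (m-injective : ∀ x y → m x ≈ m y → x ∼ y)
    (m-nonneg : ∀ x → 0# ≤ m x) (m≤T : ∀ x → m x ≤ T)
    (_∙_ : Op₂ A) (neg : Op₁ A) (0ᴬ 1ᴬ : A)
    (m-⊕ : ∀ x y → m (x ∙ y) ≈ m x ⊞ m y)
    (m-neg : ∀ x → m (neg x) ≈ T - m x)
    (m-0 : m 0ᴬ ≈ 0#) (m-1 : m 1ᴬ ≈ T)
    where

    open IsEquivalence isEquivalence using () renaming (sym to ≈ᴬ-sym; trans to ≈ᴬ-trans)

    infix 4 _≈ᴬ_
    _≈ᴬ_ : Rel A 0ℓ
    _≈ᴬ_ = _∼_

    infixl 6 _⊕_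
    _⊕_ : Op₂ A
    _⊕_ = _∙_

    ⊕-cong : ∀ {x y u w} → x ≈ᴬ y → u ≈ᴬ w → x ⊕ u ≈ᴬ y ⊕ w
    ⊕-cong {x} {y} {u} {w} x≈y u≈w = m-injective (x ⊕ u) (y ⊕ w) (begin-equality
      m (x ⊕ u)  ≈⟨ m-⊕ x u ⟩
      m x ⊞ m u  ≈⟨ ⊞-cong (m-cong x y x≈y) (m-cong u w u≈w) ⟩
      m y ⊞ m w  ≈⟨ m-⊕ y w ⟨
      m (y ⊕ w)  ∎)

    neg-cong : ∀ {x y} → x ≈ᴬ y → neg x ≈ᴬ neg y
    neg-cong {x} {y} x≈y = m-injective (neg x) (neg y) (begin-equality
      m (neg x)  ≈⟨ m-neg x ⟩
      T - m x    ≈⟨ +-congˡ (-‿cong (m-cong x y x≈y)) ⟩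
      T - m y    ≈⟨ m-neg y ⟨
      m (neg y)  ∎)

    ⊕-comm : ∀ x y → x ⊕ y ≈ᴬ y ⊕ x
    ⊕-comm x y = m-injective (x ⊕ y) (y ⊕ x) (begin-equality
      m (x ⊕ y)  ≈⟨ m-⊕ x y ⟩
      m x ⊞ m y  ≈⟨ ⊞-comm (m x) (m y) ⟩
      m y ⊞ m x  ≈⟨ m-⊕ y x ⟨
      m (y ⊕ x)  ∎)

    ⊕-assoc : ∀ x y z → (x ⊕ y) ⊕ z ≈ᴬ x ⊕ (y ⊕ z)
    ⊕-assoc x y z = m-injective ((x ⊕ y) ⊕ z) (x ⊕ (y ⊕ z)) (begin-equality
      m ((x ⊕ y) ⊕ z)    ≈⟨ m-⊕ (x ⊕ y) z ⟩
      m (x ⊕ y) ⊞ m z    ≈⟨ ⊞-cong (m-⊕ x y) refl ⟩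
      m x ⊞ m y ⊞ m z    ≈⟨ ⊞-assoc (m y) (m-nonneg x) (m-nonneg z) ⟩
      m x ⊞ (m y ⊞ m z)  ≈⟨ ⊞-cong refl (m-⊕ y z) ⟨
      m x ⊞ m (y ⊕ z)    ≈⟨ m-⊕ x (y ⊕ z) ⟨
      m (x ⊕ (y ⊕ z))    ∎)

    ⊕-identityˡ : ∀ x → 0ᴬ ⊕ x ≈ᴬ x
    ⊕-identityˡ x = m-injective (0ᴬ ⊕ x) x (begin-equality
      m (0ᴬ ⊕ x)  ≈⟨ m-⊕ 0ᴬ x ⟩
      m 0ᴬ ⊞ m x  ≈⟨ ⊞-cong m-0 refl ⟩
      0# ⊞ m x    ≈⟨ ⊞-identityˡ (m≤T x) ⟩
      m x         ∎)

    ⊕-zeroˡ : ∀ x → 1ᴬ ⊕ x ≈ᴬ 1ᴬ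
    ⊕-zeroˡ x = m-injective (1ᴬ ⊕ x) 1ᴬ (begin-equality
      m (1ᴬ ⊕ x)  ≈⟨ m-⊕ 1ᴬ x ⟩
      m 1ᴬ ⊞ m x  ≈⟨ ⊞-cong m-1 refl ⟩
      T ⊞ m x     ≈⟨ ⊞-zeroˡ (m-nonneg x) ⟩
      T           ≈⟨ m-1 ⟨
      m 1ᴬ        ∎)

    neg-0 : neg 0ᴬ ≈ᴬ 1ᴬ
    neg-0 = m-injective (neg 0ᴬ) 1ᴬ (begin-equality
      m (neg 0ᴬ)  ≈⟨ m-neg 0ᴬ ⟩
      T - m 0ᴬ    ≈⟨ +-congˡ (-‿cong m-0) ⟩
      T - 0#      ≈⟨ solve 1 (λ t → t :- :0 := t) refl T ⟩
      T           ≈⟨ m-1 ⟨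
      m 1ᴬ        ∎)

    ⊕-neg-0 : ∀ x → x ⊕ neg 0ᴬ ≈ᴬ neg 0ᴬ
    ⊕-neg-0 x = ≈ᴬ-trans (⊕-cong {x} {x} {neg 0ᴬ} {1ᴬ} (IsEquivalence.refl isEquivalence) neg-0)
      (≈ᴬ-trans (⊕-comm x 1ᴬ) (≈ᴬ-trans (⊕-zeroˡ x) (≈ᴬ-sym neg-0)))

    neg-involutive : ∀ x → neg (neg x) ≈ᴬ x
    neg-involutive x = m-injective (neg (neg x)) x (begin-equality
      m (neg (neg x))  ≈⟨ m-neg (neg x) ⟩
      T - m (neg x)    ≈⟨ +-congˡ (-‿cong (m-neg x)) ⟩
      T - (T - m x)    ≈⟨ solve 2 (λ t x → t :- (t :- x) := x) refl T (m x) ⟩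
      m x              ∎)

    m-⊕-neg : ∀ x y → m (neg (neg x ⊕ y) ⊕ y) ≈
      (T - ((T - m x) ⊞ m y)) ⊞ m y
    m-⊕-neg x y = begin-equality
      m (neg (neg x ⊕ y) ⊕ y)        ≈⟨ m-⊕ (neg (neg x ⊕ y)) y ⟩
      m (neg (neg x ⊕ y)) ⊞ m y      ≈⟨ ⊞-cong (m-neg (neg x ⊕ y)) refl ⟩
      (T - m (neg x ⊕ y)) ⊞ m y      ≈⟨ ⊞-cong (+-congˡ (-‿cong (trans (m-⊕ (neg x) y) (⊞-cong (m-neg x) refl)))) refl ⟩
      (T - ((T - m x) ⊞ m y)) ⊞ m y  ∎

    exchange : ∀ x y → neg (neg x ⊕ y) ⊕ y ≈ᴬ neg (neg y ⊕ x) ⊕ x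
    exchange x y = m-injective (neg (neg x ⊕ y) ⊕ y) (neg (neg y ⊕ x) ⊕ x)
      (trans (m-⊕-neg x y) (trans (⊞-exchange (m≤T x) (m≤T y)) (sym (m-⊕-neg y x))))

    isCommutativeMonoid : IsCommutativeMonoid _≈ᴬ_ _⊕_ 0ᴬ
    isCommutativeMonoid = record
      { isMonoid = record
        { isSemigroup = record
          { isMagma = record
            { isEquivalence = isEquivalence
            ; ∙-cong        = λ {x} {y} {u} {w} → ⊕-cong {x} {y} {u} {w}
            }
          ; assoc = ⊕-assoc
          }
        ; identity = ⊕-identityˡ , λ x → ≈ᴬ-trans (⊕-comm x 0ᴬ) (⊕-identityˡ x)
        }
      ; comm = ⊕-comm
      }

    isMVAlgebra : IsMVAlgebra _≈ᴬ_ _⊕_ neg 0ᴬ 1ᴬ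
    isMVAlgebra = record
      { isCommutativeMonoid = isCommutativeMonoid
      ; neg-cong            = λ {x} {y} → neg-cong {x} {y}
      ; neg-involutive      = neg-involutive
      ; 1-zeroˡ             = ⊕-zeroˡ
      ; neg0-zeroʳ          = ⊕-neg-0
      ; exchange            = exchange
      }

-- The punctured square

module Annulus (em : ExcludedMiddle 0ℓ) (R : CompleteOrderedField)
               (k : CompleteOrderedField.Carrier R)
               (0<k : CompleteOrderedField._<_ R (CompleteOrderedField.0# R) k)
               (k<1 : CompleteOrderedField._<_ R k (CompleteOrderedField.1# R)) where
  open CompleteOrderedField R
  open IntegerCoefficients commutativeRing using (solve; _:=_; _:+_; _:*_; _:-_; :0; :1)
  open OrderedField em R
  open Measure em R
  open IntermediateValue em R
  open PuncturedSquare R k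
  open Łukasiewicz em R total-area
  open PosetReasoning poset

  d e : Carrier
  d = ½ R - ½ R * k
  e = ½ R + ½ R * k

  ½*2≈1 : ½ R * (1# + 1#) ≈ 1#
  ½*2≈1 = proj₁ (proj₂ (inverse (2≉0 R)))

  0≤½ : 0# ≤ ½ R
  0≤½ = ≮⇒≥ λ (½≤0 , _) → 0≉1 (antisym (0≤1 R) (begin
    1#                 ≈⟨ ½*2≈1 ⟨
    ½ R * (1# + 1#)    ≈⟨ solve 1 (λ h → h :* (:1 :+ :1) := h :+ h) refl (½ R) ⟩
    ½ R + ½ R          ≤⟨ +-mono-≤ ½≤0 ½≤0 ⟩
    0# + 0#            ≈⟨ +-identityˡ 0# ⟩
    0#                 ∎))

  d+e≈1 : d + e ≈ 1#
  d+e≈1 = trans (solve 2 (λ h k → (h :- h :* k) :+ (h :+ h :* k) := h :* (:1 :+ :1)) refl (½ R) k) ½*2≈1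

  e-d≈k : e - d ≈ k
  e-d≈k = begin-equality
    e - d                ≈⟨ solve 2 (λ h k → (h :+ h :* k) :- (h :- h :* k) := h :* (:1 :+ :1) :* k) refl (½ R) k ⟩
    ½ R * (1# + 1#) * k  ≈⟨ *-congʳ ½*2≈1 ⟩
    1# * k               ≈⟨ *-identityˡ k ⟩
    k                    ∎

  1-d≈e : 1# - d ≈ e
  1-d≈e = trans (+-congʳ (sym d+e≈1)) (solve 2 (λ d e → (d :+ e) :- d := e) refl d e)

  1-e≈d : 1# - e ≈ d
  1-e≈d = trans (+-congʳ (sym d+e≈1)) (solve 2 (λ d e → (d :+ e) :- e := d) refl d e)

  d≤e : d ≤ e
  d≤e = ≤-from-difference (proj₁ 0<k) (sym e-d≈k)

  0≤d : 0# ≤ d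
  0≤d = ≤-from-difference (*-nonneg 0≤½ (sub-nonneg R (proj₁ k<1)))
    (solve 2 (λ h k → h :* (:1 :- k) := (h :- h :* k) :- :0) refl (½ R) k)

  e≤1 : e ≤ 1#
  e≤1 = ≤-from-difference 0≤d (sym 1-e≈d)

  -- The value of φ: below level a, the hole Q₁ takes away area k (clip a − d).
  v : Carrier → Carrier
  v a = a - k * (clip d e a - d)

  -- The three summands are the heights between levels `a` and `b` that lie below, beside and above
  -- the hole.
  level-difference : ∀ a b →
    ((b ⊓ d) - (a ⊓ d)) + (clip d e b - clip d e a) + ((b ⊔ e) - (a ⊔ e)) ≈ b - a
  level-difference a b = begin-equality
    ((b ⊓ d) - (a ⊓ d)) + (clip d e b - clip d e a) + ((b ⊔ e) - (a ⊔ e))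
      ≈⟨ solve 6 (λ m m′ c c′ M M′ → (m′ :- m) :+ (c′ :- c) :+ (M′ :- M) := (m′ :+ c′ :+ M′) :- (m :+ c :+ M)) refl
           (a ⊓ d) (b ⊓ d) (clip d e a) (clip d e b) (a ⊔ e) (b ⊔ e) ⟩
    ((b ⊓ d) + clip d e b + (b ⊔ e)) - ((a ⊓ d) + clip d e a + (a ⊔ e))
      ≈⟨ +-cong (clip-decomposition d≤e b) (-‿cong (clip-decomposition d≤e a)) ⟩
    (b + d + e) - (a + d + e)
      ≈⟨ solve 4 (λ a b d e → (b :+ d :+ e) :- (a :+ d :+ e) := b :- a) refl a b d e ⟩
    b - a ∎

  clip-lipschitz : ∀ {a b} → a ≤ b → clip d e b - clip d e a ≤ b - a
  clip-lipschitz {a} {b} a≤b = shift₂ (⊓-monoˡ-≤ d a≤b) (⊔-monoˡ-≤ e a≤b) (begin-equality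
    ((b ⊓ d) - (a ⊓ d)) + ((b ⊔ e) - (a ⊔ e))
      ≈⟨ solve 3 (λ m c M → m :+ M := (m :+ c :+ M) :- c) refl ((b ⊓ d) - (a ⊓ d)) (clip d e b - clip d e a) ((b ⊔ e) - (a ⊔ e)) ⟩
    (((b ⊓ d) - (a ⊓ d)) + (clip d e b - clip d e a) + ((b ⊔ e) - (a ⊔ e))) - (clip d e b - clip d e a)
      ≈⟨ +-congʳ (level-difference a b) ⟩
    (b - a) - (clip d e b - clip d e a) ∎)

  v-lipschitz : ∀ {a b} → a ≤ b → v b - v a ≤ b - a
  v-lipschitz {a} {b} a≤b = ≤-from-difference (*-nonneg (proj₁ 0<k) (sub-nonneg R (clip-mono-≤ a≤b)))
    (solve 6 (λ a b c c′ d k → k :* (c′ :- c) := (b :- a) :- ((b :- k :* (c′ :- d)) :- (a :- k :* (c :- d))))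
      refl a b (clip d e a) (clip d e b) d k)

  -- Even beside the hole a row keeps length 1 - k. As `k < 1`, this rate is positive, which is what
  -- makes `v` reflect the order in `v-cancel-≤`.
  v-growth : ∀ {a b} → a ≤ b → (1# - k) * (b - a) ≤ v b - v a
  v-growth {a} {b} a≤b = ≤-from-difference (*-nonneg (proj₁ 0<k) (sub-nonneg R (clip-lipschitz a≤b)))
    (solve 6 (λ a b c c′ d k →
      k :* ((b :- a) :- (c′ :- c)) := ((b :- k :* (c′ :- d)) :- (a :- k :* (c :- d))) :- (:1 :- k) :* (b :- a))
      refl a b (clip d e a) (clip d e b) d k)

  v-mono-≤ : ∀ {a b} → a ≤ b → v a ≤ v b
  v-mono-≤ {a} {b} a≤b = shift₂ (*-nonneg (sub-nonneg R (proj₁ k<1)) (sub-nonneg R a≤b)) (v-growth a≤b)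
    (solve 3 (λ s a b → (s :- :0) :+ ((b :- a) :- s) := b :- a) refl ((1# - k) * (b - a)) (v a) (v b))

  v-cancel-≤ : ∀ {a b} → v a ≤ v b → a ≤ b
  v-cancel-≤ {a} {b} va≤vb = ≮⇒≥ λ b<a → <⇒≱ (*-pos (sub-pos k<1) (sub-pos b<a))
    (shift₂ (v-growth (proj₁ b<a)) va≤vb
      (solve 3 (λ s x y → ((x :- y) :- s) :+ (y :- x) := :0 :- s) refl ((1# - k) * (a - b)) (v a) (v b)))

  v0≈0 : v 0# ≈ 0#
  v0≈0 = begin-equality
    0# - k * (clip d e 0# - d)  ≈⟨ +-congˡ (-‿cong (*-congˡ (+-congʳ (clip-below d≤e 0≤d)))) ⟩
    0# - k * (d - d)            ≈⟨ solve 2 (λ k d → :0 :- k :* (d :- d) := :0) refl k d ⟩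
    0#                          ∎

  v1≈total : v 1# ≈ total-area
  v1≈total = begin-equality
    1# - k * (clip d e 1# - d)  ≈⟨ +-congˡ (-‿cong (*-congˡ (+-congʳ (clip-above d≤e e≤1)))) ⟩
    1# - k * (e - d)            ≈⟨ +-congˡ (-‿cong (*-congˡ e-d≈k)) ⟩
    1# - k * k                  ∎

  reflect-≤ : ∀ {a b} → a ≤ b → 1# - b ≤ 1# - a
  reflect-≤ {a} {b} a≤b = shift a≤b (solve 2 (λ a b → b :- a := (:1 :- a) :- (:1 :- b)) refl a b)

  clip-reflect : ∀ b → clip d e (1# - b) ≈ 1# - clip d e b
  clip-reflect b = cases (total b d) (total b e)
    where
    cases : b ≤ d ⊎ d ≤ b → b ≤ e ⊎ e ≤ b → clip d e (1# - b) ≈ 1# - clip d e b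
    cases (inj₁ b≤d) _ = begin-equality
      clip d e (1# - b)  ≈⟨ clip-above d≤e (≤-trans (≤-reflexive (sym 1-d≈e)) (reflect-≤ b≤d)) ⟩
      e                  ≈⟨ 1-d≈e ⟨
      1# - d             ≈⟨ +-congˡ (-‿cong (clip-below d≤e b≤d)) ⟨
      1# - clip d e b    ∎
    cases (inj₂ d≤b) (inj₁ b≤e) = begin-equality
      clip d e (1# - b)  ≈⟨ clip-between (≤-trans (≤-reflexive (sym 1-e≈d)) (reflect-≤ b≤e)) (≤-trans (reflect-≤ d≤b) (≤-reflexive 1-d≈e)) ⟩
      1# - b             ≈⟨ +-congˡ (-‿cong (clip-between d≤b b≤e)) ⟨
      1# - clip d e b    ∎
    cases (inj₂ d≤b) (inj₂ e≤b) = begin-equality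
      clip d e (1# - b)  ≈⟨ clip-below d≤e (≤-trans (reflect-≤ e≤b) (≤-reflexive 1-e≈d)) ⟩
      d                  ≈⟨ 1-e≈d ⟨
      1# - e             ≈⟨ +-congˡ (-‿cong (clip-above d≤e e≤b)) ⟨
      1# - clip d e b    ∎

  -- Reflection in the horizontal midline preserves the hole, so area above level 1 - b equals area
  -- below level `b`.
  v-reflect : ∀ b → v (1# - b) ≈ total-area - v b
  v-reflect b = begin-equality
    1# - b - k * (clip d e (1# - b) - d)             ≈⟨ +-congˡ (-‿cong (*-congˡ (+-congʳ (clip-reflect b)))) ⟩
    -- As a polynomial identity this fails; the two sides differ by a multiple of `k` that vanishes
    -- by the relations d + e = 1 and e - d = k.
    1# - b - k * (1# - c - d)                        ≈⟨ ≈-from-difference (*-congˡ {k} (+-cong d+e≈1 (sym e-d≈k)))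
      (solve 5 (λ b c d e k →
        (:1 :- b :- k :* (:1 :- c :- d)) :- ((:1 :- k :* k) :- (b :- k :* (c :- d))) :=
        k :* ((d :+ e) :+ k) :- k :* (:1 :+ (e :- d))) refl b c d e k) ⟩
    total-area - v b                                 ∎
    where c = clip d e b

  reflect-∈ : ∀ {b} → b ∈ UnitInterval → (1# - b) ∈ UnitInterval
  reflect-∈ {b} (0≤b , b≤1) = sub-nonneg R b≤1 ,
    shift 0≤b (solve 1 (λ b → b :- :0 := :1 :- (:1 :- b)) refl b)

  -- The strips lie below, left of, right of and above the hole. Truncating the heights lets a strip
  -- that the levels do not reach degenerate to height zero, so one list serves all positions of `a`
  -- and `b`.
  band : ∀ {a b} → a ≤ b → List Box
  band {a} {b} a≤b =
      strip 0# 1# (0≤1 R) (⊓-monoˡ-≤ d a≤b)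
    ∷ strip 0# d  0≤d     (clip-mono-≤ {d} {e} a≤b)
    ∷ strip e  1# e≤1     (clip-mono-≤ {d} {e} a≤b)
    ∷ strip 0# 1# (0≤1 R) (⊔-monoˡ-≤ e a≤b)
    ∷ []
    where
    strip : ∀ l r → l ≤ r → ∀ {b t} → b ≤ t → Box
    strip l r l≤r {b} {t} b≤t = record
      { left = l ; right = r ; bottom = b ; top = t ; left≤right = l≤r ; bottom≤top = b≤t }

  areas-band : ∀ {a b} (a≤b : a ≤ b) → areas (band a≤b) ≈ v b - v a
  areas-band {a} {b} a≤b = begin-equality
    areas (band a≤b)
      ≈⟨ solve 5 (λ m c M d e →
           (:1 :- :0) :* m :+ ((d :- :0) :* c :+ ((:1 :- e) :* c :+ ((:1 :- :0) :* M :+ :0))) :=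
           (m :+ c :+ M) :- (e :- d) :* c) refl ((b ⊓ d) - (a ⊓ d)) (clip d e b - clip d e a) ((b ⊔ e) - (a ⊔ e)) d e ⟩
    (((b ⊓ d) - (a ⊓ d)) + (clip d e b - clip d e a) + ((b ⊔ e) - (a ⊔ e))) - (e - d) * (clip d e b - clip d e a)
      ≈⟨ +-cong (level-difference a b) (-‿cong (*-congʳ e-d≈k)) ⟩
    (b - a) - k * (clip d e b - clip d e a)
      ≈⟨ solve 6 (λ a b c c′ d k → (b :- a) :- k :* (c′ :- c) := (b :- k :* (c′ :- d)) :- (a :- k :* (c :- d))) refl
           a b (clip d e a) (clip d e b) d k ⟩
    v b - v a ∎

  ∈-band : ∀ {a b x y} (a≤b : a ≤ b) → (x , y) ∈ Q → (x , y) ∉ Q₁ → a ≤ y → y ≤ b → (x , y) ∈ ⋃ (band a≤b)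
  ∈-band {a} {b} {x} {y} a≤b ((0≤x , x≤1) , _) ∉Q₁ a≤y y≤b =
    cases (≤-or-> y d) (≤-or-> e y) (≤-or-> x d) (≤-or-> e x)
    where
    cases : y ≤ d ⊎ d < y → e ≤ y ⊎ y < e → x ≤ d ⊎ d < x → e ≤ x ⊎ x < e → (x , y) ∈ ⋃ (band a≤b)
    cases (inj₁ y≤d) _ _ _ = here ((0≤x , x≤1) , (≤-trans (x⊓y≤x a d) a≤y , ⊓-glb y≤b y≤d))
    cases (inj₂ _) (inj₁ e≤y) _ _ =
      there (there (there (here ((0≤x , x≤1) , (⊔-lub a≤y e≤y , ≤-trans y≤b (x≤x⊔y b e))))))
    cases (inj₂ d<y) (inj₂ y<e) x≤d? e≤x? = beside x≤d? e≤x?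
      where
      clip≤y : clip d e a ≤ y
      clip≤y = ⊔-lub (proj₁ d<y) (≤-trans (x⊓y≤x a e) a≤y)
      y≤clip : y ≤ clip d e b
      y≤clip = ≤-trans (⊓-glb y≤b (proj₁ y<e)) (x≤y⊔x d (b ⊓ e))
      beside : x ≤ d ⊎ d < x → e ≤ x ⊎ x < e → (x , y) ∈ ⋃ (band a≤b)
      beside (inj₁ x≤d) _          = there (here ((0≤x , x≤d) , clip≤y , y≤clip))
      beside (inj₂ _) (inj₁ e≤x)   = there (there (here ((e≤x , x≤1) , clip≤y , y≤clip)))
      beside (inj₂ d<x) (inj₂ x<e) = ⊥-elim (∉Q₁ ((d<x , x<e) , (d<y , y<e)))

  hole : Box
  hole = record { left = d ; right = e ; bottom = d ; top = e ; left≤right = d≤e ; bottom≤top = d≤e }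

  Q₁⊆hole : Q₁ ⊆ closed hole
  Q₁⊆hole ((d<x , x<e) , (d<y , y<e)) = (proj₁ d<x , proj₁ x<e) , (proj₁ d<y , proj₁ y<e)

  area-hole : area hole ≈ k * k
  area-hole = *-cong e-d≈k e-d≈k

  -- The complement of a region includes the hole, which is covered by its closure. That closure
  -- meets the strips only along edges, so the areas still add up to 1.
  cover-hole : ∀ {F : Region} {L} → (∀ {p} → p ∈ Q → p ∉ Q₁ → p ∈ F ⊎ p ∈ ⋃ L) → Q ⊆ (F ∪ ⋃ (hole ∷ L))
  cover-hole {F} {L} cover {p} p∈Q = cases em
    where
    cases : Dec (p ∈ Q₁) → p ∈ F ⊎ p ∈ ⋃ (hole ∷ L)
    cases (yes p∈Q₁) = inj₂ (here (Q₁⊆hole p∈Q₁))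
    cases (no p∉Q₁)  = map₂ there (cover p∈Q p∉Q₁)

  -- Measures of lower and upper regions

  φ≈v : ∀ {a} → a ∈ UnitInterval → φ a ≈ v a
  φ≈v {a} (0≤a , a≤1) = trans
    (μ-exact (lower a) (band 0≤a) (hole ∷ band a≤1)
      (λ (_ , (p∈Q , y≤a) , ∉Q₁) → ∈-band 0≤a p∈Q ∉Q₁ (proj₁ (proj₂ p∈Q)) y≤a)
      (cover-hole cover)
      (begin-equality
        areas (band 0≤a) + (area hole + areas (band a≤1))
          ≈⟨ +-cong (areas-band 0≤a) (+-cong area-hole (areas-band a≤1)) ⟩
        (v a - v 0#) + (k * k + (v 1# - v a))
          ≈⟨ +-cong (+-congˡ (-‿cong v0≈0)) (+-congˡ (+-congʳ v1≈total)) ⟩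
        (v a - 0#) + (k * k + (1# - k * k - v a))
          ≈⟨ solve 2 (λ x s → (x :- :0) :+ (s :+ (:1 :- s :- x)) := :1) refl (v a) (k * k) ⟩
        1# ∎))
    (trans (areas-band 0≤a) (trans (+-congˡ (-‿cong v0≈0)) (solve 1 (λ x → x :- :0 := x) refl (v a))))
    where
    cover : ∀ {p} → p ∈ Q → p ∉ Q₁ → p ∈ lower a ⊎ p ∈ ⋃ (band a≤1)
    cover {_ , y} p∈Q p∉Q₁ = [ (λ y≤a → inj₁ ((p∈Q , y≤a) , p∉Q₁))
                             , (λ a≤y → inj₂ (∈-band a≤1 p∈Q p∉Q₁ a≤y (proj₂ (proj₂ p∈Q))))
                             ]′ (total y a)

  -- What the two regions leave uncovered is the hole and the band between the levels `a` and 1 - b.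
  μ-disjoint : ∀ {a b} → a ∈ UnitInterval → b ∈ UnitInterval → a ≤ 1# - b →
               μ (lower a ∪ upper b) ≈ v a + v b
  μ-disjoint {a} {b} (0≤a , a≤1) b∈I a≤1-b = trans
    (μ-exact (lower a ∪ upper b) (band 0≤a ++ band 1-b≤1) (hole ∷ band a≤1-b) outer (cover-hole inner)
      (begin-equality
        areas (band 0≤a ++ band 1-b≤1) + (area hole + areas (band a≤1-b))
          ≈⟨ +-cong areas≈ (+-cong area-hole (trans (areas-band a≤1-b) (+-congʳ (v-reflect b)))) ⟩
        (v a + v b) + (k * k + (1# - k * k - v b - v a))
          ≈⟨ solve 3 (λ x y s → (x :+ y) :+ (s :+ (:1 :- s :- y :- x)) := :1) refl (v a) (v b) (k * k) ⟩
        1# ∎))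
    areas≈
    where
    1-b≤1 = proj₂ (reflect-∈ b∈I)

    areas≈ : areas (band 0≤a ++ band 1-b≤1) ≈ v a + v b
    areas≈ = begin-equality
      areas (band 0≤a ++ band 1-b≤1)          ≈⟨ areas-++ (band 0≤a) (band 1-b≤1) ⟩
      areas (band 0≤a) + areas (band 1-b≤1)   ≈⟨ +-cong (areas-band 0≤a) (areas-band 1-b≤1) ⟩
      (v a - v 0#) + (v 1# - v (1# - b))      ≈⟨ +-cong (+-congˡ (-‿cong v0≈0)) (+-cong v1≈total (-‿cong (v-reflect b))) ⟩
      (v a - 0#) + (total-area - (total-area - v b))
        ≈⟨ solve 3 (λ x y t → (x :- :0) :+ (t :- (t :- y)) := x :+ y) refl (v a) (v b) total-area ⟩
      v a + v b                               ∎

    outer : (Q ∩ (lower a ∪ upper b)) ⊆ ⋃ (band 0≤a ++ band 1-b≤1)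
    outer (_ , inj₁ ((p∈Q , y≤a) , p∉Q₁))   = ++⁺ˡ (∈-band 0≤a p∈Q p∉Q₁ (proj₁ (proj₂ p∈Q)) y≤a)
    outer (_ , inj₂ ((p∈Q , 1-b≤y) , p∉Q₁)) = ++⁺ʳ (band 0≤a) (∈-band 1-b≤1 p∈Q p∉Q₁ 1-b≤y (proj₂ (proj₂ p∈Q)))

    inner : ∀ {p} → p ∈ Q → p ∉ Q₁ → p ∈ (lower a ∪ upper b) ⊎ p ∈ ⋃ (band a≤1-b)
    inner {_ , y} p∈Q p∉Q₁ = cases (total y a) (total y (1# - b))
      where
      cases : y ≤ a ⊎ a ≤ y → y ≤ 1# - b ⊎ 1# - b ≤ y → (_ , y) ∈ (lower a ∪ upper b) ⊎ (_ , y) ∈ ⋃ (band a≤1-b)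
      cases (inj₁ y≤a) _            = inj₁ (inj₁ ((p∈Q , y≤a) , p∉Q₁))
      cases (inj₂ _) (inj₂ 1-b≤y)   = inj₁ (inj₂ ((p∈Q , 1-b≤y) , p∉Q₁))
      cases (inj₂ a≤y) (inj₁ y≤1-b) = inj₂ (∈-band a≤1-b p∈Q p∉Q₁ a≤y y≤1-b)

  1∈I : 1# ∈ UnitInterval
  1∈I = 0≤1 R , ≤-refl

  μ-overlapping : ∀ {a b} → 1# - b ≤ a → μ (lower a ∪ upper b) ≈ total-area
  μ-overlapping {a} {b} 1-b≤a = trans (antisym (μ-mono ⊆lower1) (μ-mono lower1⊆)) (trans (φ≈v 1∈I) v1≈total)
    where
    ⊆lower1 : (Q ∩ (lower a ∪ upper b)) ⊆ lower 1#
    ⊆lower1 (p∈Q , inj₁ (_ , p∉Q₁)) = (p∈Q , proj₂ (proj₂ p∈Q)) , p∉Q₁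
    ⊆lower1 (p∈Q , inj₂ (_ , p∉Q₁)) = (p∈Q , proj₂ (proj₂ p∈Q)) , p∉Q₁

    lower1⊆ : (Q ∩ lower 1#) ⊆ (lower a ∪ upper b)
    lower1⊆ {_ , y} (p∈Q , _ , p∉Q₁) = [ (λ y≤a → inj₁ ((p∈Q , y≤a) , p∉Q₁))
                                        , (λ a≤y → inj₂ ((p∈Q , ≤-trans 1-b≤a a≤y) , p∉Q₁))
                                        ]′ (total y a)

  φ-reflect : ∀ {a} → a ∈ UnitInterval → φ (1# - a) ≈ total-area - φ a
  φ-reflect {a} a∈I = trans (φ≈v (reflect-∈ a∈I)) (trans (v-reflect a) (+-congˡ (-‿cong (sym (φ≈v a∈I)))))

  φ1≈total : φ 1# ≈ total-area
  φ1≈total = trans (φ≈v 1∈I) v1≈total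

  φ-cancel-≤ : ∀ {a b} → a ∈ UnitInterval → b ∈ UnitInterval → φ a ≤ φ b → a ≤ b
  φ-cancel-≤ a∈I b∈I φa≤φb = v-cancel-≤
    (≤-trans (≤-reflexive (sym (φ≈v a∈I))) (≤-trans φa≤φb (≤-reflexive (φ≈v b∈I))))

  φ-mono-≤ : ∀ {a b} → a ∈ UnitInterval → b ∈ UnitInterval → a ≤ b → φ a ≤ φ b
  φ-mono-≤ a∈I b∈I a≤b =
    ≤-trans (≤-reflexive (φ≈v a∈I)) (≤-trans (v-mono-≤ a≤b) (≤-reflexive (sym (φ≈v b∈I))))

  φ-nonneg : ∀ {a} → a ∈ UnitInterval → 0# ≤ φ a
  φ-nonneg {a} (0≤a , a≤1) = begin
    0#    ≈⟨ v0≈0 ⟨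
    v 0#  ≤⟨ v-mono-≤ 0≤a ⟩
    v a   ≈⟨ φ≈v (0≤a , a≤1) ⟨
    φ a   ∎

  φ≤total : ∀ {a} → a ∈ UnitInterval → φ a ≤ total-area
  φ≤total a∈I = ≤-trans (φ-mono-≤ a∈I 1∈I (proj₂ a∈I)) (≤-reflexive φ1≈total)

  φ-surjective : ∀ {t} → 0# ≤ t → t ≤ total-area → ∃[ l ] l ∈ UnitInterval × φ l ≈ t
  φ-surjective 0≤t t≤total =
    let l , l∈I , vl≈t = intermediate-value v v-mono-≤ v-lipschitz
          (≤-trans (≤-reflexive v0≈0) 0≤t) (≤-trans t≤total (≤-reflexive (sym v1≈total)))
    in l , l∈I , trans (φ≈v l∈I) vl≈t

  -- By `φ-reflect`, comparing `a` with 1 - b amounts to comparing `φ a + φ b` with the total area,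
  -- so the geometric cases are those of the truncation.
  μ-lower∪upper : ∀ {a b} → a ∈ UnitInterval → b ∈ UnitInterval →
                  μ (lower a ∪ upper b) ≈ φ a ⊞ φ b
  μ-lower∪upper {a} {b} a∈I b∈I = cases (total a (1# - b))
    where
    cases : a ≤ 1# - b ⊎ 1# - b ≤ a → μ (lower a ∪ upper b) ≈ φ a ⊞ φ b
    cases (inj₁ a≤1-b) = begin-equality
      μ (lower a ∪ upper b)  ≈⟨ μ-disjoint a∈I b∈I a≤1-b ⟩
      v a + v b              ≈⟨ +-cong (φ≈v a∈I) (φ≈v b∈I) ⟨
      φ a + φ b              ≈⟨ ⊞-small (shift (≤-trans (φ-mono-≤ a∈I (reflect-∈ b∈I) a≤1-b) (≤-reflexive (φ-reflect b∈I)))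
                                  (solve 3 (λ x y t → (t :- y) :- x := t :- (x :+ y)) refl (φ a) (φ b) total-area)) ⟨
      φ a ⊞ φ b              ∎
    cases (inj₂ 1-b≤a) = begin-equality
      μ (lower a ∪ upper b)  ≈⟨ μ-overlapping 1-b≤a ⟩
      total-area             ≈⟨ ⊞-large (shift (≤-trans (≤-reflexive (sym (φ-reflect b∈I))) (φ-mono-≤ (reflect-∈ b∈I) a∈I 1-b≤a))
                                  (solve 3 (λ x y t → x :- (t :- y) := (x :+ y) :- t) refl (φ a) (φ b) total-area)) ⟨
      φ a ⊞ φ b              ∎

  -- The regions as functions of their measure

  lower-mono : ∀ {a b} → a ≤ b → lower a ⊆ lower b
  lower-mono a≤b ((p∈Q , y≤a) , p∉Q₁) = (p∈Q , ≤-trans y≤a a≤b) , p∉Q₁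

  T⁰φ≐lower : ∀ {l} → l ∈ UnitInterval → T⁰ (φ l) ≐ lower l
  T⁰φ≐lower l∈I =
    (λ (l′ , l′∈I , φl′≈φl , p∈) → lower-mono (φ-cancel-≤ l′∈I l∈I (≤-reflexive φl′≈φl)) p∈) ,
    λ p∈ → _ , l∈I , refl , p∈

  T¹φ≐upper : ∀ {l} → l ∈ UnitInterval → T¹ (φ l) ≐ upper l
  T¹φ≐upper l∈I =
    (λ (l′ , l′∈I , φl′≈φl , (p∈Q , 1-l′≤y) , p∉Q₁) →
      (p∈Q , ≤-trans (reflect-≤ (φ-cancel-≤ l′∈I l∈I (≤-reflexive φl′≈φl))) 1-l′≤y) , p∉Q₁) ,
    λ p∈ → _ , l∈I , refl , p∈

  μ-T⁰∪T¹ : ∀ {a b} → a ∈ UnitInterval → b ∈ UnitInterval → μ (T⁰ (φ a) ∪ T¹ (φ b)) ≈ φ a ⊞ φ b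
  μ-T⁰∪T¹ {a} {b} a∈I b∈I = trans (antisym (μ-mono to) (μ-mono from)) (μ-lower∪upper a∈I b∈I)
    where
    to : (Q ∩ (T⁰ (φ a) ∪ T¹ (φ b))) ⊆ (lower a ∪ upper b)
    to (_ , inj₁ p∈) = inj₁ (proj₁ (T⁰φ≐lower a∈I) p∈)
    to (_ , inj₂ p∈) = inj₂ (proj₁ (T¹φ≐upper b∈I) p∈)
    from : (Q ∩ (lower a ∪ upper b)) ⊆ (T⁰ (φ a) ∪ T¹ (φ b))
    from (_ , inj₁ p∈) = inj₁ (proj₂ (T⁰φ≐lower a∈I) p∈)
    from (_ , inj₂ p∈) = inj₂ (proj₂ (T¹φ≐upper b∈I) p∈)

  T⁰-cong : ∀ {s t} → s ≈ t → T⁰ s ≐ T⁰ t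
  T⁰-cong s≈t = (λ (l , l∈I , φl≈s , p∈) → l , l∈I , trans φl≈s s≈t , p∈) ,
                (λ (l , l∈I , φl≈t , p∈) → l , l∈I , trans φl≈t (sym s≈t) , p∈)

  -- The algebra of regions

  Value : Set
  Value = ∃[ t ] 0# ≤ t × t ≤ total-area

  value : 𝒯⁰ → Value
  value (_ , l , l∈I , _) = φ l , φ-nonneg l∈I , φ≤total l∈I

  measureOf : 𝒯⁰ → Carrier
  measureOf = proj₁ ∘ value

  -- The operations prescribe a measure, whereas membership in `𝒯⁰` asks for a level; surjectivity
  -- of `φ` supplies one.
  withMeasure : Value → 𝒯⁰
  withMeasure (_ , 0≤t , t≤total) = let l , l∈I , _ = φ-surjective 0≤t t≤total in T⁰φ l l∈I

  measureOf-withMeasure : ∀ t → measureOf (withMeasure t) ≈ proj₁ t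
  measureOf-withMeasure (_ , 0≤t , t≤total) = proj₂ (proj₂ (φ-surjective 0≤t t≤total))

  withMeasure≐T⁰ : ∀ {s} t → proj₁ t ≈ s → ⟦ withMeasure t ⟧ ≐ T⁰ s
  withMeasure≐T⁰ t t≈s = T⁰-cong (trans (measureOf-withMeasure t) t≈s)

  measureOf-injective : ∀ x y → measureOf x ≈ measureOf y → x ≈𝒯 y
  measureOf-injective (_ , _ , _ , S≐) (_ , _ , _ , S′≐) φl≈φl′ =
    ≐-trans S≐ (≐-trans (T⁰-cong φl≈φl′) (≐-sym S′≐))

  -- `measureOf` reads the stored level and not the region, so equal regions with different levels
  -- have to be excluded.
  measureOf-cong : ∀ x y → x ≈𝒯 y → measureOf x ≈ measureOf y
  measureOf-cong (_ , l , l∈I , S≐) (_ , l′ , l′∈I , S′≐) S≐S′ =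
    antisym (bound l∈I l′∈I (≐-trans (≐-sym S≐) (≐-trans S≐S′ S′≐)))
            (bound l′∈I l∈I (≐-trans (≐-sym S′≐) (≐-trans (≐-sym S≐S′) S≐)))
    where
    -- The point (0 , l) lies outside the hole, so it distinguishes the levels.
    bound : ∀ {l l′} → l ∈ UnitInterval → l′ ∈ UnitInterval → T⁰ (φ l) ≐ T⁰ (φ l′) → φ l ≤ φ l′
    bound {l} l∈I l′∈I (⊆ , _) = φ-mono-≤ l∈I l′∈I (proj₂ (proj₁ (proj₁ (T⁰φ≐lower l′∈I)
      (⊆ (proj₂ (T⁰φ≐lower l∈I) {0# , l} ((((≤-refl , 0≤1 R) , l∈I) , ≤-refl) , λ ((d<0 , _) , _) → <⇒≱ d<0 0≤d))))))

  0≤total : 0# ≤ total-area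
  0≤total = ≤-trans (φ-nonneg 1∈I) (φ≤total 1∈I)

  0ᵛ 1ᵛ : Value
  0ᵛ = 0# , ≤-refl , 0≤total
  1ᵛ = total-area , 0≤total , ≤-refl

  _⊕ᵛ_ : Op₂ Value
  (s , 0≤s , _) ⊕ᵛ (t , 0≤t , _) = s ⊞ t , ⊞-nonneg 0≤total 0≤s 0≤t , x⊓y≤y (s + t) total-area

  negᵛ : Op₁ Value
  negᵛ (t , 0≤t , t≤total) = total-area - t , sub-nonneg R t≤total ,
    shift 0≤t (solve 2 (λ T t → t :- :0 := T :- (T :- t)) refl total-area t)

  infixl 6 _⊕_
  -- Defined through measures so that it is total on `𝒯⁰`; the prescribed union of regions is
  -- recovered from `μ-T⁰∪T¹`.
  _⊕_ : Op₂ 𝒯⁰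
  x ⊕ y = withMeasure (value x ⊕ᵛ value y)

  neg : Op₁ 𝒯⁰
  neg x = withMeasure (negᵛ (value x))

  0𝒯 1𝒯 : 𝒯⁰
  0𝒯 = withMeasure 0ᵛ
  1𝒯 = withMeasure 1ᵛ

  definingEquations : DefiningEquations _⊕_ neg 0𝒯 1𝒯
  definingEquations = record
    { ⊕-def   = λ a b a∈I b∈I →
        withMeasure≐T⁰ (value (T⁰φ a a∈I) ⊕ᵛ value (T⁰φ b b∈I)) (sym (μ-T⁰∪T¹ a∈I b∈I))
    ; neg-def = λ l l∈I → withMeasure≐T⁰ (negᵛ (value (T⁰φ l l∈I))) refl
    ; 0-def   = withMeasure≐T⁰ 0ᵛ refl
    ; 1-def   = withMeasure≐T⁰ 1ᵛ refl
    ; 1≐Q∖Q₁  = ≐-trans (withMeasure≐T⁰ 1ᵛ (sym φ1≈total)) (≐-trans (T⁰φ≐lower 1∈I)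
        ((λ ((p∈Q , _) , p∉Q₁) → p∈Q , p∉Q₁) , λ (p∈Q , p∉Q₁) → (p∈Q , proj₂ (proj₂ p∈Q)) , p∉Q₁))
    }

  measureOf-⊕ : ∀ x y → measureOf (x ⊕ y) ≈ measureOf x ⊞ measureOf y
  measureOf-⊕ x y = measureOf-withMeasure (value x ⊕ᵛ value y)

  measureOf-neg : ∀ x → measureOf (neg x) ≈ total-area - measureOf x
  measureOf-neg x = measureOf-withMeasure (negᵛ (value x))

  isMVAlgebra : IsMVAlgebra _≈𝒯_ _⊕_ neg 0𝒯 1𝒯
  isMVAlgebra = Pullback.isMVAlgebra _≈𝒯_ (record { refl = ≐-refl ; sym = ≐-sym ; trans = ≐-trans })
    measureOf measureOf-cong measureOf-injective
    (λ x → proj₁ (proj₂ (value x))) (λ x → proj₂ (proj₂ (value x)))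
    _⊕_ neg 0𝒯 1𝒯 measureOf-⊕ measureOf-neg
    (measureOf-withMeasure 0ᵛ) (measureOf-withMeasure 1ᵛ)

theorem6 : ExcludedMiddle 0ℓ →
    (R : CompleteOrderedField) →
    let open CompleteOrderedField R in
    (k : Carrier) → 0# < k → k < 1# →
    let open PuncturedSquare R k in
    (∀ l → l ∈ UnitInterval → (T⁰ (φ l) ≐ lower l) × (T¹ (φ l) ≐ upper l)) ×
    (Σ (Op₂ 𝒯⁰) λ _⊕_ → Σ (Op₁ 𝒯⁰) λ neg → Σ 𝒯⁰ λ 0𝒯 → Σ 𝒯⁰ λ 1𝒯 →
    DefiningEquations _⊕_ neg 0𝒯 1𝒯 ×
    IsMVAlgebra _≈𝒯_ _⊕_ neg 0𝒯 1𝒯)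
theorem6 em R k 0<k k<1 =
  (λ l l∈I → T⁰φ≐lower l∈I , T¹φ≐upper l∈I) ,
  _⊕_ , neg , 0𝒯 , 1𝒯 , definingEquations , isMVAlgebra
  where open Annulus em R k 0<k k<1
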